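{- Let $k\ge1$ and $1\le i\le k$ be integers and let $\overline{\mathcal E}_{k,i}(a,q)=\sum_{n,j\ge0}\overline{E}_{k,i}(n,j)\,q^na^j$. Then $$\overline{\mathcal E}_{k,i}(a,q)=\frac{(-aq)_\infty}{(q)_\infty}\sum_{n=-\infty}^{\infty}(-1)^na^nq^{kn^2+(k-i+1)n}\frac{(-1/a)_n}{(-aq)_n}.$$
   Context: $(x)_\infty=(x;q)_\infty=\prod_{m\ge0}(1-xq^m)$ and $(x)_n=(x)_\infty/(xq^n)_\infty$ for every integer $n$ (including negative $n$). $\overline{E}_{k,i}(n,j)$ is the number of lattice paths satisfying the special $(k,i)$-conditions with major index $n$ and $j$ South steps, where: paths lie in the first quadrant, start on the $y$-axis, end on the $x$-axis, and use unit steps North-East $(x,y)\to(x+1,y+1)$, South-East $(x,y)\to(x+1,y-1)$, South $(x,y)\to(x,y-1)$, East $(x,0)\to(x+1,0)$ (East steps only at height $0$); a South step may only occur immediately after a North-East step; a path is either empty or ends with a South-East or South step. The special $(k,i)$-conditions: the path starts at $(0,k-i)$ and every vertex has $y$-coordinate $<k$. A peak is a vertex preceded by a North-East step and followed by a South or South-East step; the major index is the sum of the $x$-coordinates of the peaks. -}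

module Defs where

open import Data.Bool using (Bool; true; false; _∧_; if_then_else_)
open import Data.Nat as ℕ using (ℕ; zero; suc; _≡ᵇ_; _<ᵇ_; _≤ᵇ_; _∸_; _%_)
open import Data.Integer as ℤ using (ℤ; +_; -[1+_]; -_)
open import Data.List using (List; []; _∷_; length; filterᵇ; concatMap; map; _++_)
open import Data.Product using (∃; _×_)
open import Relation.Binary.PropositionalEquality using (_≡_)

data Step : Set where
  NE SE S E : Step

wordsOf : ℕ → List (List Step)
wordsOf zero    = [] ∷ []
wordsOf (suc L) = concatMap (λ w → (NE ∷ w) ∷ (SE ∷ w) ∷ (S ∷ w) ∷ (E ∷ w) ∷ []) (wordsOf L)

wordsUpTo : ℕ → List (List Step)
wordsUpTo zero    = wordsOf zero
wordsUpTo (suc L) = wordsOf (suc L) ++ wordsUpTo L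

walk : ℕ → ℕ → Bool → List Step → Bool
walk k y       b     []        = y ≡ᵇ 0
walk k y       b     (NE ∷ ss) = (suc y <ᵇ k) ∧ walk k (suc y) true ss
walk k zero    b     (SE ∷ ss) = false
walk k (suc y) b     (SE ∷ ss) = walk k y false ss
walk k zero    b     (S ∷ ss)  = false
walk k (suc y) false (S ∷ ss)  = false
walk k (suc y) true  (S ∷ ss)  = walk k y false ss
walk k zero    b     (E ∷ ss)  = walk k zero false ss
walk k (suc y) b     (E ∷ ss)  = false

endsDown : List Step → Bool
endsDown []             = true
endsDown (SE ∷ [])      = true
endsDown (S ∷ [])       = true
endsDown (NE ∷ [])      = false
endsDown (E ∷ [])       = false
endsDown (_ ∷ s ∷ ss)   = endsDown (s ∷ ss)

validPath : ℕ → ℕ → List Step → Bool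
validPath k i ss = ((k ∸ i) <ᵇ k) ∧ (walk k (k ∸ i) false ss ∧ endsDown ss)

-- major index: sum of x-coordinates of peaks (vertex preceded by NE and
-- followed by S or SE); x = current x-coordinate, b = previous step was NE
majorFrom : ℕ → Bool → List Step → ℕ
majorFrom x b []        = 0
majorFrom x b (NE ∷ ss) = majorFrom (suc x) true ss
majorFrom x b (SE ∷ ss) = (if b then x else 0) ℕ.+ majorFrom (suc x) false ss
majorFrom x b (S ∷ ss)  = (if b then x else 0) ℕ.+ majorFrom x false ss
majorFrom x b (E ∷ ss)  = majorFrom (suc x) false ss

majorIndex : List Step → ℕ
majorIndex = majorFrom 0 false

southSteps : List Step → ℕ
southSteps []        = 0
southSteps (S ∷ ss)  = suc (southSteps ss)
southSteps (_ ∷ ss)  = southSteps ss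

-- number of paths with at most L steps satisfying the special
-- (k,i)-conditions, with major index n and j South steps.
-- Ē_{k,i}(n,j) is the eventual (stable) value of this as L → ∞.
countPathsUpTo : ℕ → ℕ → ℕ → ℕ → ℕ → ℕ
countPathsUpTo k i L n j =
  length (filterᵇ (λ ss → validPath k i ss ∧ ((majorIndex ss ≡ᵇ n) ∧ (southSteps ss ≡ᵇ j)))
                  (wordsUpTo L))

-- Formal power series in a, q with integer coefficients:
-- f N J = coefficient of q^N a^J.

PS : Set
PS = ℕ → ℕ → ℤ

bool→ℤ : Bool → ℤ
bool→ℤ true  = + 1
bool→ℤ false = + 0

sumTo : ℕ → (ℕ → ℤ) → ℤ
sumTo zero    f = f 0
sumTo (suc N) f = sumTo N f ℤ.+ f (suc N)

_⊛_ : PS → PS → PS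
(f ⊛ g) N J = sumTo N (λ n → sumTo J (λ j → f n j ℤ.* g (N ∸ n) (J ∸ j)))

infixl 7 _⊛_

oneS : PS
oneS N J = bool→ℤ ((N ≡ᵇ 0) ∧ (J ≡ᵇ 0))

sgn : ℕ → ℤ
sgn zero    = + 1
sgn (suc n) = - sgn n

scale : ℤ → PS → PS
scale c f N J = c ℤ.* f N J

qShift : ℕ → PS → PS
qShift e f N J = if e ≤ᵇ N then f (N ∸ e) J else + 0

onePlusAQ : ℕ → PS
onePlusAQ r N J = oneS N J ℤ.+ bool→ℤ ((N ≡ᵇ r) ∧ (J ≡ᵇ 1))

-- 1/(1 + a q^r) = Σ_t (-1)^t a^t q^{r t}   (r ≥ 1)
invOnePlusAQ : ℕ → PS
invOnePlusAQ r N J = if N ≡ᵇ r ℕ.* J then sgn J else + 0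

-- 1/(1 - q^m) = Σ_t q^{m t}   (m ≥ 1)
invOneMinusQ : ℕ → PS
invOneMinusQ m N J = if (J ≡ᵇ 0) ∧ (N % suc (m ∸ 1) ≡ᵇ 0) then + 1 else + 0

aPlusQ : ℕ → PS
aPlusQ r N J = bool→ℤ ((N ≡ᵇ 0) ∧ (J ≡ᵇ 1)) ℤ.+ bool→ℤ ((N ≡ᵇ r) ∧ (J ≡ᵇ 0))

prodFrom : ℕ → ℕ → (ℕ → PS) → PS
prodFrom s zero    f = oneS
prodFrom s (suc n) f = f s ⊛ prodFrom (suc s) n f

-- ∏_{m ≥ 1} f m for factors with f m ≡ 1 (mod q^m): the coefficient of
-- q^N is that of the finite product over 1 ≤ m ≤ N.
infProd : (ℕ → PS) → PS
infProd f N J = prodFrom 1 N f N J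

negAQ∞ : PS
negAQ∞ = infProd onePlusAQ

invQ∞ : PS
invQ∞ = infProd invOneMinusQ

invNegAQ : ℕ → PS
invNegAQ m = prodFrom 1 m invOnePlusAQ

-- a^m (-1/a; q)_m = ∏_{r=0}^{m-1} (a + q^r)
aPowNegInvA : ℕ → PS
aPowNegInvA m = prodFrom 0 m aPlusQ

-- The n-th summand  (-1)^n a^n q^{k n² + (k-i+1) n} (-1/a)_n / (-aq)_n,
-- n ∈ ℤ, written as an element of ℤ[[a,q]]:
--   n = m ≥ 0 : (-1)^m q^{k m² + (k-i+1) m} ∏_{r<m}(a+q^r) / (-aq)_m
--   n = -m < 0: (-1)^m q^{k m² - (k-i) m}   ∏_{r<m}(a+q^r) / (-aq)_m
summand : ℕ → ℕ → ℤ → PS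
summand k i (+ m) =
  scale (sgn m) (qShift (k ℕ.* m ℕ.* m ℕ.+ suc (k ∸ i) ℕ.* m) (aPowNegInvA m ⊛ invNegAQ m))
summand k i -[1+ m' ] =
  scale (sgn (suc m')) (qShift (k ℕ.* suc m' ℕ.* suc m' ∸ (k ∸ i) ℕ.* suc m')
                               (aPowNegInvA (suc m') ⊛ invNegAQ (suc m')))

symSum : ℕ → (ℤ → ℤ) → ℤ
symSum zero    g = g (+ 0)
symSum (suc B) g = symSum B g ℤ.+ (g (+ suc B) ℤ.+ g -[1+ B ])

IsSumℤ : (ℤ → PS) → PS → Set
IsSumℤ T Sm = ∀ N J → ∃ λ B₀ → ∀ B → B₀ ℕ.≤ B → Sm N J ≡ symSum B (λ n → T n N J)

{-# OPTIONS --safe #-}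

-- Count paths by their number N of peaks.  Removing the first step, the paths starting at height
-- y with N peaks have generating function ∏_{r<N}(a + q^r) f_y(N), and those starting just after
-- a North-East step ∏_{r<N}(a + q^r) g_y(N), where
--   f_y(N) = q^N (g_{y+1}(N) + f_{y-1}(N)),   g_y(N) = q^N g_{y+1}(N) + f_{y-1}(N-1),
--   f_{-1} = f_0,   g_k = 0,   f_y(0) = 1.
-- These recurrences determine f and g, and they are solved by
--   f_y(N) = q^{N(N+1)/2} Σ_n (-1)^n q^{kn² - n(n-1)/2 + ny} / ((q)_{N-n} (q)_{N+n}),
-- each summand satisfying the recurrences and the symmetries n ↔ -n and n ↔ -1-n giving the
-- boundary conditions.  Summing over N first, each n contributes a case of the 1φ1 summation, which
-- follows from V_s = (1 + a q^{m+s+1}) V_{s+1} for a one-parameter deformation V_s of the sum.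
-- All of this takes place in ℤ[[a,q]] modulo a^{j+1} and q^{n+1}, so that every sum is finite.

module Submission where

open import Defs
open import Algebra.Bundles using (CommutativeRing)
import Algebra.Properties.Semiring.Exp as Exp
open import Data.Bool using (Bool; true; false; _∧_; if_then_else_; T)
import Data.Bool.Properties as Boolₚ
open import Data.Integer as ℤ using (ℤ; +_; -[1+_])
import Data.Integer.Properties as ℤₚ
open import Data.List using (List; []; _∷_; _++_; concatMap; filterᵇ; length)
open import Data.Nat as ℕ using (ℕ; zero; suc; z≤n; s≤s; _≤_; _<_; _∸_; _<ᵇ_; _≤ᵇ_; _≡ᵇ_)
open import Data.Nat.DivMod using (_%_; m<n⇒m%n≡m; [m+n]%n≡m%n)
import Data.Nat.Properties as ℕₚ
open import Data.Nat.Solver using () renaming (module +-*-Solver to NS)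
open import Data.Product using (∃; _×_; _,_)
open import Data.Unit using (tt)
open import Function using (_∘_; Equivalence)
open import Level using (_⊔_)
open import Relation.Binary.PropositionalEquality as ≡ using (_≡_)
open import Relation.Nullary using (contradiction; yes; no)

-- Only peaks carry weight, so moving a path with N peaks one unit to the right multiplies its
-- weight by q^N; this is the source of every factor q^N in the recurrences. A path leaving its
-- first peak by a South step gains a, and one leaving it by a South-East step moves the other N-1
-- peaks and gains q^{N-1}; hence the product of the a + q^r. A first-step recurrence alone has no
-- base case, since East steps can be repeated for ever. Nilpotency of q provides one: far enough to
-- the right, any peak has weight 0. Counts and closed forms are then compared by induction towards
-- large abscissae. The identities are proved over an abstract ring with a nilpotent q, and only at
-- the end is the ring made concrete and a coefficient read off.

module PowerSeries {c ℓ} (A : CommutativeRing c ℓ) where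
  open CommutativeRing A
  open import Algebra.Properties.CommutativeSemigroup +-commutativeSemigroup
    using (interchange; x∙yz≈y∙xz)
  open import Algebra.Properties.CommutativeSemigroup *-commutativeSemigroup
    using () renaming (x∙yz≈y∙xz to x*yz≈y*xz)
  open import Relation.Binary.Reasoning.Setoid setoid

  -- Formal power series and their truncations

  Series : Set c
  Series = ℕ → Carrier

  const : Carrier → Series
  const x zero    = x
  const x (suc n) = 0#

  -- The Cauchy product as a recursion on the left factor, so that the ring laws follow by induction
  -- without any subtraction of indices.
  _⋆_ : Series → Series → Series
  (f ⋆ g) zero    = f 0 * g 0
  (f ⋆ g) (suc n) = f 0 * g (suc n) + ((f ∘ suc) ⋆ g) n

  -- Coefficient n of a product depends only on coefficients up to n, so the product respects
  -- equality up to a bound.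
  ⋆-cong≤ : ∀ {f f′ g g′} n → (∀ m → m ≤ n → f m ≈ f′ m) → (∀ m → m ≤ n → g m ≈ g′ m) →
            (f ⋆ g) n ≈ (f′ ⋆ g′) n
  ⋆-cong≤ zero    p r = *-cong (p 0 z≤n) (r 0 z≤n)
  ⋆-cong≤ (suc n) p r = +-cong (*-cong (p 0 z≤n) (r (suc n) ℕₚ.≤-refl))
    (⋆-cong≤ n (λ m m≤n → p (suc m) (s≤s m≤n)) (λ m m≤n → r m (ℕₚ.m≤n⇒m≤1+n m≤n)))

  ⋆-cong : ∀ {f f′ g g′} → (∀ m → f m ≈ f′ m) → (∀ m → g m ≈ g′ m) → ∀ n →
           (f ⋆ g) n ≈ (f′ ⋆ g′) n
  ⋆-cong p r n = ⋆-cong≤ n (λ m _ → p m) (λ m _ → r m)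

  ⋆-last : ∀ f g n → (f ⋆ g) (suc n) ≈ f (suc n) * g 0 + (f ⋆ (g ∘ suc)) n
  ⋆-last f g zero    = +-comm _ _
  ⋆-last f g (suc n) = begin
    f 0 * g (2 ℕ.+ n) + ((f ∘ suc) ⋆ g) (suc n)
      ≈⟨ +-congˡ (⋆-last (f ∘ suc) g n) ⟩
    f 0 * g (2 ℕ.+ n) + (f (2 ℕ.+ n) * g 0 + ((f ∘ suc) ⋆ (g ∘ suc)) n)
      ≈⟨ x∙yz≈y∙xz _ _ _ ⟩
    f (2 ℕ.+ n) * g 0 + (f ⋆ (g ∘ suc)) (suc n) ∎

  ⋆-comm : ∀ f g n → (f ⋆ g) n ≈ (g ⋆ f) n
  ⋆-comm f g zero    = *-comm _ _
  ⋆-comm f g (suc n) = trans (+-cong (*-comm _ _) (⋆-comm (f ∘ suc) g n)) (sym (⋆-last g f n))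

  ⋆-distribˡ : ∀ f g h n → (f ⋆ (λ m → g m + h m)) n ≈ (f ⋆ g) n + (f ⋆ h) n
  ⋆-distribˡ f g h zero    = distribˡ _ _ _
  ⋆-distribˡ f g h (suc n) =
    trans (+-cong (distribˡ _ _ _) (⋆-distribˡ (f ∘ suc) g h n)) (interchange _ _ _ _)

  ⋆-distribʳ : ∀ f g h n → ((λ m → g m + h m) ⋆ f) n ≈ (g ⋆ f) n + (h ⋆ f) n
  ⋆-distribʳ f g h n = trans (⋆-comm _ f n)
    (trans (⋆-distribˡ f g h n) (+-cong (⋆-comm f g n) (⋆-comm f h n)))

  ⋆-scaleˡ : ∀ x f g n → ((λ m → x * f m) ⋆ g) n ≈ x * (f ⋆ g) n
  ⋆-scaleˡ x f g zero    = *-assoc _ _ _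
  ⋆-scaleˡ x f g (suc n) =
    trans (+-cong (*-assoc _ _ _) (⋆-scaleˡ x (f ∘ suc) g n)) (sym (distribˡ _ _ _))

  ⋆-assoc : ∀ f g h n → ((f ⋆ g) ⋆ h) n ≈ (f ⋆ (g ⋆ h)) n
  ⋆-assoc f g h zero    = *-assoc _ _ _
  ⋆-assoc f g h (suc n) = begin
    f 0 * g 0 * h (suc n) + ((λ m → f 0 * g (suc m) + ((f ∘ suc) ⋆ g) m) ⋆ h) n
      ≈⟨ +-cong (*-assoc _ _ _) (⋆-distribʳ h _ _ n) ⟩
    f 0 * (g 0 * h (suc n)) + (((λ m → f 0 * g (suc m)) ⋆ h) n + (((f ∘ suc) ⋆ g) ⋆ h) n)
      ≈⟨ +-congˡ (+-cong (⋆-scaleˡ _ _ h n) (⋆-assoc (f ∘ suc) g h n)) ⟩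
    f 0 * (g 0 * h (suc n)) + (f 0 * ((g ∘ suc) ⋆ h) n + ((f ∘ suc) ⋆ (g ⋆ h)) n)
      ≈⟨ +-assoc _ _ _ ⟨
    f 0 * (g 0 * h (suc n)) + f 0 * ((g ∘ suc) ⋆ h) n + ((f ∘ suc) ⋆ (g ⋆ h)) n
      ≈⟨ +-congʳ (distribˡ _ _ _) ⟨
    (f ⋆ (g ⋆ h)) (suc n) ∎

  ⋆-zeroˡ : ∀ f n → ((λ _ → 0#) ⋆ f) n ≈ 0#
  ⋆-zeroˡ f zero    = zeroˡ _
  ⋆-zeroˡ f (suc n) = trans (+-cong (zeroˡ _) (⋆-zeroˡ f n)) (+-identityˡ _)

  const-⋆ : ∀ x f n → (const x ⋆ f) n ≈ x * f n
  const-⋆ x f zero    = refl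
  const-⋆ x f (suc n) = trans (+-congˡ (⋆-zeroˡ f n)) (+-identityʳ _)

  ⋆-identityˡ : ∀ f n → (const 1# ⋆ f) n ≈ f n
  ⋆-identityˡ f n = trans (const-⋆ 1# f n) (*-identityˡ _)

  -- The quotient by X^{N+1}. Elements remain full series and only equality is coarsened, so nothing
  -- has to be cut off and an equation yields its coefficients by application.
  truncated : ℕ → CommutativeRing c ℓ
  truncated N = record
    { Carrier = Series
    ; _≈_ = λ f g → ∀ n → n ≤ N → f n ≈ g n
    ; _+_ = λ f g n → f n + g n
    ; _*_ = _⋆_
    ; -_ = λ f n → - f n
    ; 0# = λ _ → 0#
    ; 1# = const 1#
    ; isCommutativeRing = record
      { isRing = record
        { +-isAbelianGroup = record
          { isGroup = record
            { isMonoid = record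
              { isSemigroup = record
                { isMagma = record
                  { isEquivalence = record
                    { refl = λ _ _ → refl
                    ; sym = λ p n l → sym (p n l)
                    ; trans = λ p r n l → trans (p n l) (r n l)
                    }
                  ; ∙-cong = λ p r n l → +-cong (p n l) (r n l)
                  }
                ; assoc = λ f g h n _ → +-assoc (f n) (g n) (h n)
                }
              ; identity = (λ f n _ → +-identityˡ (f n)) , (λ f n _ → +-identityʳ (f n))
              }
            ; inverse = (λ f n _ → -‿inverseˡ (f n)) , (λ f n _ → -‿inverseʳ (f n))
            ; ⁻¹-cong = λ p n l → -‿cong (p n l)
            }
          ; comm = λ f g n _ → +-comm (f n) (g n)
          }
        ; *-cong = λ p r n l → ⋆-cong≤ n (λ m m≤n → p m (ℕₚ.≤-trans m≤n l))
                                          (λ m m≤n → r m (ℕₚ.≤-trans m≤n l))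
        ; *-assoc = λ f g h n _ → ⋆-assoc f g h n
        ; *-identity = (λ f n _ → ⋆-identityˡ f n)
                     , (λ f n _ → trans (⋆-comm f _ n) (⋆-identityˡ f n))
        ; distrib = (λ f g h n _ → ⋆-distribˡ f g h n) , (λ f g h n _ → ⋆-distribʳ f g h n)
        }
      ; *-comm = λ f g n _ → ⋆-comm f g n
      }
    }

-- Finite sums in a commutative ring

module FiniteSums {c ℓ} (R : CommutativeRing c ℓ) where
  open CommutativeRing R
  open import Algebra.Properties.CommutativeSemigroup +-commutativeSemigroup using (interchange)
  open import Relation.Binary.Reasoning.Setoid setoid

  ∑ : ℕ → (ℕ → Carrier) → Carrier
  ∑ zero    f = 0#
  ∑ (suc n) f = ∑ n f + f n

  ∑-cong : ∀ n {f g} → (∀ m → f m ≈ g m) → ∑ n f ≈ ∑ n g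
  ∑-cong zero    p = refl
  ∑-cong (suc n) p = +-cong (∑-cong n p) (p n)

  ∑-zero : ∀ n {f} → (∀ m → m < n → f m ≈ 0#) → ∑ n f ≈ 0#
  ∑-zero zero    p = refl
  ∑-zero (suc n) p = trans
    (+-cong (∑-zero n (λ m m<n → p m (ℕₚ.m≤n⇒m≤1+n m<n))) (p n ℕₚ.≤-refl)) (+-identityˡ _)

  ∑-+ : ∀ n f g → ∑ n (λ m → f m + g m) ≈ ∑ n f + ∑ n g
  ∑-+ zero    f g = sym (+-identityˡ _)
  ∑-+ (suc n) f g = trans (+-congʳ (∑-+ n f g)) (interchange _ _ _ _)

  *-∑ : ∀ x n f → x * ∑ n f ≈ ∑ n (λ m → x * f m)
  *-∑ x zero    f = zeroʳ x
  *-∑ x (suc n) f = trans (distribˡ _ _ _) (+-congʳ (*-∑ x n f))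

  ∑-linear : ∀ n {f g k} x → (∀ m → f m ≈ g m + x * k m) → ∑ n f ≈ ∑ n g + x * ∑ n k
  ∑-linear n x p = trans (∑-cong n p) (trans (∑-+ n _ _) (+-congˡ (sym (*-∑ x n _))))

  ∑-swap : ∀ n k (f : ℕ → ℕ → Carrier) →
           ∑ n (λ i → ∑ k (λ j → f i j)) ≈ ∑ k (λ j → ∑ n (λ i → f i j))
  ∑-swap zero    k f = sym (∑-zero k (λ _ _ → refl))
  ∑-swap (suc n) k f = trans (+-congʳ (∑-swap n k f)) (sym (∑-+ k _ _))

  ∑-split : ∀ n k f → ∑ (n ℕ.+ k) f ≈ ∑ n f + ∑ k (λ j → f (n ℕ.+ j))
  ∑-split n zero    f = trans (reflexive (≡.cong (λ l → ∑ l f) (ℕₚ.+-identityʳ n)))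
                              (sym (+-identityʳ _))
  ∑-split n (suc k) f = begin
    ∑ (n ℕ.+ suc k) f                                 ≡⟨ ≡.cong (λ l → ∑ l f) (ℕₚ.+-suc n k) ⟩
    ∑ (n ℕ.+ k) f + f (n ℕ.+ k)                       ≈⟨ +-congʳ (∑-split n k f) ⟩
    ∑ n f + ∑ k (λ j → f (n ℕ.+ j)) + f (n ℕ.+ k)     ≈⟨ +-assoc _ _ _ ⟩
    ∑ n f + ∑ (suc k) (λ j → f (n ℕ.+ j))             ∎

  ∑-head : ∀ n f → ∑ (suc n) f ≈ f 0 + ∑ n (f ∘ suc)
  ∑-head n f = trans (∑-split 1 n f) (+-congʳ (+-identityˡ _))

  -- The hypothesis is v t - w t = D t - D (t + 1) cleared of subtraction, which lets the semiring
  -- solver check it.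
  ∑-telescope : ∀ (v w D : ℕ → Carrier) → (∀ t → v t + D (suc t) ≈ w t + D t) →
                ∀ n → ∑ n v + D n ≈ ∑ n w + D 0
  ∑-telescope v w D p zero    = refl
  ∑-telescope v w D p (suc n) = begin
    ∑ n v + v n + D (suc n)     ≈⟨ +-assoc _ _ _ ⟩
    ∑ n v + (v n + D (suc n))   ≈⟨ +-congˡ (trans (p n) (+-comm _ _)) ⟩
    ∑ n v + (D n + w n)         ≈⟨ +-assoc _ _ _ ⟨
    ∑ n v + D n + w n           ≈⟨ +-congʳ (∑-telescope v w D p n) ⟩
    ∑ n w + D 0 + w n           ≈⟨ +-assoc _ _ _ ⟩
    ∑ n w + (D 0 + w n)         ≈⟨ +-congˡ (+-comm _ _) ⟩
    ∑ n w + (w n + D 0)         ≈⟨ +-assoc _ _ _ ⟨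
    ∑ (suc n) w + D 0           ∎

-- triangle m = m (m - 1) / 2
triangle : ℕ → ℕ
triangle zero    = 0
triangle (suc m) = triangle m ℕ.+ m

-- iq-inverse says (1 - q^{n+1}) iq n = 1; without subtraction all identities below are in reach
-- of the commutative semiring solver.
record NilpotentBase {c ℓ} (R : CommutativeRing c ℓ) : Set (c ⊔ ℓ) where
  open CommutativeRing R
  open Exp semiring using (_^_)
  field
    a q        : Carrier
    M          : ℕ
    q^M≈0      : q ^ M ≈ 0#
    iq ia      : ℕ → Carrier
    iq-inverse : ∀ n → iq n ≈ 1# + q ^ suc n * iq n
    ia-inverse : ∀ n → (1# + a * q ^ suc n) * ia n ≈ 1#

-- q-series with a nilpotent q

module QSeries {ℓ₁ ℓ₂} (R : CommutativeRing ℓ₁ ℓ₂) (base : NilpotentBase R) where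
  open CommutativeRing R
  open NilpotentBase base
  open Exp semiring using (_^_; ^-homo-*; ^-congʳ)
  open import Algebra.Solver.Ring.NaturalCoefficients.Default commutativeSemiring
    using (solve; _:+_; _:*_; _:=_; con)
  open import Algebra.Properties.CommutativeSemigroup +-commutativeSemigroup using (interchange)
  open import Relation.Binary.Reasoning.Setoid setoid
  open FiniteSums R

  q^≥M : ∀ {n} → M ≤ n → q ^ n ≈ 0#
  q^≥M {n} M≤n = begin
    q ^ n                      ≡⟨ ≡.cong (q ^_) (ℕₚ.m+[n∸m]≡n M≤n) ⟨
    q ^ (M ℕ.+ (n ∸ M))      ≈⟨ ^-homo-* q M _ ⟩
    q ^ M * q ^ (n ∸ M)      ≈⟨ *-congʳ q^M≈0 ⟩
    0# * q ^ (n ∸ M)         ≈⟨ zeroˡ _ ⟩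
    0#                         ∎

  invQPoch : ℕ → Carrier
  invQPoch zero    = 1#
  invQPoch (suc n) = iq n * invQPoch n

  -- invQPochDiff N m = 1/(q)_{N-m}, which vanishes for m > N.
  invQPochDiff : ℕ → ℕ → Carrier
  invQPochDiff N       zero    = invQPoch N
  invQPochDiff zero    (suc m) = 0#
  invQPochDiff (suc N) (suc m) = invQPochDiff N m

  P : ℕ → Carrier
  P zero    = 1#
  P (suc n) = P n * (a + q ^ n)

  aqPoch : ℕ → Carrier
  aqPoch zero    = 1#
  aqPoch (suc n) = (1# + a * q ^ suc n) * aqPoch n

  invAQPoch : ℕ → Carrier
  invAQPoch zero    = 1#
  invAQPoch (suc n) = ia n * invAQPoch n

  sign : ℕ → Carrier
  sign zero    = 1#
  sign (suc m) = - sign m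

  u : ℕ → Carrier
  u N = q ^ triangle (suc N)

  τ : ℕ → Carrier
  τ N = u N * P N

  u-suc : ∀ N → u (suc N) ≈ q ^ suc N * u N
  u-suc N = trans (^-homo-* q (triangle (suc N)) (suc N)) (*-comm _ _)

  u≥M : ∀ {N} → M ≤ N → u N ≈ 0#
  u≥M {N} M≤N = q^≥M (ℕₚ.≤-trans M≤N (ℕₚ.m≤n+m N (triangle N)))

  invQPoch-suc : ∀ n → invQPoch (suc n) ≈ invQPoch n + q ^ suc n * invQPoch (suc n)
  invQPoch-suc n = begin
    iq n * invQPoch n                          ≈⟨ *-congʳ (iq-inverse n) ⟩
    (1# + q ^ suc n * iq n) * invQPoch n
      ≈⟨ solve 3 (λ x y z → (con 1 :+ x :* y) :* z := z :+ x :* (y :* z)) refl (q ^ suc n) (iq n) (invQPoch n) ⟩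
    invQPoch n + q ^ suc n * (iq n * invQPoch n) ∎

  -- Reading 1/(q)_{n-1} as `invQPochDiff n 1`, which is 0 at n = 0, spares the telescoping below a
  -- separate first term.
  invQPoch-pred : ∀ n → invQPoch n ≈ invQPochDiff n 1 + q ^ n * invQPoch n
  invQPoch-pred zero    = solve 0 (con 1 := con 0 :+ con 1 :* con 1) refl
  invQPoch-pred (suc n) = invQPoch-suc n

  -- Every further factor is 1 because its power of q vanishes; the infinite product is thus reached
  -- at a finite index.
  invQPoch-stable : ∀ d {n} → M ≤ suc n → invQPoch (d ℕ.+ n) ≈ invQPoch n
  invQPoch-stable zero    M≤ = refl
  invQPoch-stable (suc d) {n} M≤ = begin
    invQPoch (suc (d ℕ.+ n))     ≈⟨ invQPoch-suc (d ℕ.+ n) ⟩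
    invQPoch (d ℕ.+ n) + q ^ suc (d ℕ.+ n) * _
      ≈⟨ +-cong (invQPoch-stable d M≤)
           (trans (*-congʳ (q^≥M (ℕₚ.≤-trans M≤ (s≤s (ℕₚ.m≤n+m n d))))) (zeroˡ _)) ⟩
    invQPoch n + 0#              ≈⟨ +-identityʳ _ ⟩
    invQPoch n                   ∎

  aqPoch-stable : ∀ d {n} → M ≤ suc n → aqPoch (d ℕ.+ n) ≈ aqPoch n
  aqPoch-stable zero    M≤ = refl
  aqPoch-stable (suc d) {n} M≤ = begin
    (1# + a * q ^ suc (d ℕ.+ n)) * aqPoch (d ℕ.+ n)
      ≈⟨ *-cong (+-congˡ (trans (*-congˡ (q^≥M (ℕₚ.≤-trans M≤ (s≤s (ℕₚ.m≤n+m n d))))) (zeroʳ a)))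
                (aqPoch-stable d M≤) ⟩
    (1# + 0#) * aqPoch n   ≈⟨ *-congʳ (+-identityʳ 1#) ⟩
    1# * aqPoch n          ≈⟨ *-identityˡ _ ⟩
    aqPoch n               ∎

  invAQPoch-inverse : ∀ n → invAQPoch n * aqPoch n ≈ 1#
  invAQPoch-inverse zero    = *-identityˡ 1#
  invAQPoch-inverse (suc n) = begin
    ia n * invAQPoch n * ((1# + a * q ^ suc n) * aqPoch n)
      ≈⟨ solve 4 (λ x y z w → x :* y :* (z :* w) := (z :* x) :* (y :* w)) refl _ _ _ _ ⟩
    (1# + a * q ^ suc n) * ia n * (invAQPoch n * aqPoch n)
      ≈⟨ *-cong (ia-inverse n) (invAQPoch-inverse n) ⟩
    1# * 1#  ≈⟨ *-identityˡ 1# ⟩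
    1#       ∎

  invQPochDiff-vanish : ∀ {N m} → N < m → invQPochDiff N m ≈ 0#
  invQPochDiff-vanish {zero}  {suc m} _         = refl
  invQPochDiff-vanish {suc N} {suc m} (s≤s N<m) = invQPochDiff-vanish N<m

  invQPochDiff-cancel : ∀ m t → invQPochDiff (m ℕ.+ t) m ≡ invQPoch t
  invQPochDiff-cancel zero    t = ≡.refl
  invQPochDiff-cancel (suc m) t = invQPochDiff-cancel m t

  -- (1 - q^{N+1-m}) / (q)_{N+1-m} = 1/(q)_{N-m}, multiplied by q^m to clear the negative exponent.
  invQPochDiff-suc : ∀ N m → q ^ m * invQPochDiff (suc N) m ≈
                       q ^ m * invQPochDiff N m + q ^ suc N * invQPochDiff (suc N) m
  invQPochDiff-suc N zero = trans (*-identityˡ _) (trans (invQPoch-suc N) (+-congʳ (sym (*-identityˡ _))))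
  invQPochDiff-suc zero (suc zero) = solve 1
    (λ x → x :* con 1 :* con 1 := x :* con 1 :* con 0 :+ x :* con 1 :* con 1) refl q
  invQPochDiff-suc zero (suc (suc m)) = solve 2
    (λ x y → y :* con 0 := y :* con 0 :+ x :* con 0) refl _ _
  invQPochDiff-suc (suc N) (suc m) = begin
    q * q ^ m * invQPochDiff (suc N) m    ≈⟨ *-assoc _ _ _ ⟩
    q * (q ^ m * invQPochDiff (suc N) m)  ≈⟨ *-congˡ (invQPochDiff-suc N m) ⟩
    q * (q ^ m * invQPochDiff N m + q ^ suc N * invQPochDiff (suc N) m)
      ≈⟨ solve 5 (λ x y z w v → x :* (y :* z :+ w :* v) := x :* y :* z :+ x :* w :* v) refl _ _ _ _ _ ⟩
    q * q ^ m * invQPochDiff N m + q * q ^ suc N * invQPochDiff (suc N) m ∎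

  -- Seen as functions of n in place of m, `c` is invariant under n ↔ -n and `d` under n ↔ -1-n. So
  -- `c N m` also serves n = -m, and `d N m` also serves n = -1-m.
  c d : ℕ → ℕ → Carrier
  c N m = invQPochDiff N m * invQPoch (N ℕ.+ m)
  d N m = invQPochDiff N m * invQPoch (suc (N ℕ.+ m))

  τ-suc : ∀ N → τ (suc N) ≈ q ^ suc N * (a + q ^ N) * τ N
  τ-suc N = trans (*-congʳ (u-suc N))
    (solve 4 (λ Q u P s → Q :* u :* (P :* s) := Q :* s :* (u :* P)) refl _ _ _ _)

  τ≥M : ∀ {N} → M ≤ N → τ N ≈ 0#
  τ≥M M≤N = trans (*-congʳ (u≥M M≤N)) (zeroˡ _)

  -- Summation over the number of peaks

  module PeakSum (m : ℕ) where

    -- V 0 is the sum over N = m + t of τ N / ((q)_{N-m} (q)_{N+m}).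
    V-term : ℕ → ℕ → Carrier
    V-term s t = q ^ (s ℕ.* t) * (τ (m ℕ.+ t) * (invQPoch t * invQPoch (s ℕ.+ t ℕ.+ (m ℕ.+ m))))

    V : ℕ → Carrier
    V s = ∑ (suc M) (V-term s)

    -- The telescoping certificate: the term of `V` with 1/(q)_t lowered to 1/(q)_{t-1}. It vanishes
    -- at t = 0 because of this factor, and at t = M + 1 because of `τ`.
    D : ℕ → ℕ → Carrier
    D s t = q ^ (s ℕ.* t) * (τ (m ℕ.+ t) * (invQPochDiff t 1 * invQPoch (s ℕ.+ t ℕ.+ (m ℕ.+ m))))

    -- Taking `D s t` from `V-term s t` leaves a factor q^t. The new factor a + q^{m+t} of `τ` in
    -- `D s (suc t)` splits: its power of q raises 1/(q)_{s+t+2m} to the next index, and its a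
    -- supplies the term with a q^{m+s+1}.
    V-step : ∀ s t → V-term s t + D s (suc t) ≈
                     (1# + a * q ^ suc (s ℕ.+ m)) * V-term (suc s) t + D s t
    V-step s t = begin
      V-term s t + D s (suc t)
        ≈⟨ +-cong (*-congˡ (*-congˡ (*-congʳ (invQPoch-pred t)))) D-suc ⟩
      Qst * (τₜ * ((ρ⁻ + Qt * ρ) * X))
        + Qs * Qst * (q * Qm * Qt * (a + Qm * Qt) * τₜ * (ρ * X′))
        ≈⟨ solve 11 (λ a q Qst τₜ ρ ρ⁻ X X′ Qs Qm Qt →
             Qst :* (τₜ :* ((ρ⁻ :+ Qt :* ρ) :* X))
               :+ Qs :* Qst :* (q :* Qm :* Qt :* (a :+ Qm :* Qt) :* τₜ :* (ρ :* X′))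
             := Qt :* Qst :* (τₜ :* (ρ :* (X :+ q :* (Qs :* Qt :* (Qm :* Qm)) :* X′)))
               :+ a :* (q :* (Qs :* Qm)) :* (Qt :* Qst :* (τₜ :* (ρ :* X′)))
               :+ Qst :* (τₜ :* (ρ⁻ :* X))) refl a q Qst τₜ ρ ρ⁻ X X′ Qs Qm Qt ⟩
      Qt * Qst * (τₜ * (ρ * (X + q * (Qs * Qt * (Qm * Qm)) * X′)))
        + a * (q * (Qs * Qm)) * (Qt * Qst * (τₜ * (ρ * X′))) + D s t
        ≈⟨ +-congʳ (+-cong (*-congˡ (*-congˡ (*-congˡ X-rec))) (*-congʳ (*-congˡ (*-congˡ (^-homo-* q s m))))) ⟨
      Qt * Qst * (τₜ * (ρ * X′)) + a * q ^ suc (s ℕ.+ m) * (Qt * Qst * (τₜ * (ρ * X′))) + D s t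
        ≈⟨ +-congʳ (solve 2 (λ x y → (con 1 :+ x) :* y := y :+ x :* y) refl _ _) ⟨
      (1# + a * q ^ suc (s ℕ.+ m)) * (Qt * Qst * (τₜ * (ρ * X′))) + D s t
        ≈⟨ +-congʳ (*-congˡ (*-congʳ (^-homo-* q t (s ℕ.* t)))) ⟨
      (1# + a * q ^ suc (s ℕ.+ m)) * V-term (suc s) t + D s t ∎
      where
      Qst = q ^ (s ℕ.* t) ; τₜ = τ (m ℕ.+ t) ; ρ = invQPoch t ; ρ⁻ = invQPochDiff t 1
      X = invQPoch (s ℕ.+ t ℕ.+ (m ℕ.+ m)) ; X′ = invQPoch (suc (s ℕ.+ t ℕ.+ (m ℕ.+ m)))
      Qs = q ^ s ; Qm = q ^ m ; Qt = q ^ t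
      X-rec : X′ ≈ X + q * (Qs * Qt * (Qm * Qm)) * X′
      X-rec = begin
        X′   ≈⟨ invQPoch-suc (s ℕ.+ t ℕ.+ (m ℕ.+ m)) ⟩
        X + q * q ^ (s ℕ.+ t ℕ.+ (m ℕ.+ m)) * X′
          ≈⟨ +-congˡ (*-congʳ (*-congˡ (trans (^-homo-* q (s ℕ.+ t) (m ℕ.+ m))
               (*-cong (^-homo-* q s t) (^-homo-* q m m))))) ⟩
        X + q * (Qs * Qt * (Qm * Qm)) * X′ ∎
      D-suc : D s (suc t) ≈ Qs * Qst * (q * Qm * Qt * (a + Qm * Qt) * τₜ * (ρ * X′))
      D-suc = begin
        D s (suc t)
          ≡⟨ ≡.cong₂ (λ x y → q ^ x * (τ y * (ρ * invQPoch (s ℕ.+ suc t ℕ.+ (m ℕ.+ m)))))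
               (ℕₚ.*-suc s t) (ℕₚ.+-suc m t) ⟩
        q ^ (s ℕ.+ s ℕ.* t) * (τ (suc (m ℕ.+ t)) * (ρ * invQPoch (s ℕ.+ suc t ℕ.+ (m ℕ.+ m))))
          ≈⟨ *-cong (^-homo-* q s (s ℕ.* t)) (*-cong (τ-suc (m ℕ.+ t))
               (*-congˡ (reflexive (≡.cong (λ l → invQPoch (l ℕ.+ (m ℕ.+ m))) (ℕₚ.+-suc s t))))) ⟩
        Qs * Qst * (q * q ^ (m ℕ.+ t) * (a + q ^ (m ℕ.+ t)) * τₜ * (ρ * X′))
          ≈⟨ *-congˡ (*-congʳ (*-congʳ (*-cong
               (trans (*-congˡ (^-homo-* q m t)) (sym (*-assoc _ _ _)))
               (+-congˡ (^-homo-* q m t))))) ⟩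
        Qs * Qst * (q * Qm * Qt * (a + Qm * Qt) * τₜ * (ρ * X′)) ∎

    V-rec : ∀ s → V s ≈ (1# + a * q ^ suc (s ℕ.+ m)) * V (suc s)
    V-rec s = begin
      V s                  ≈⟨ +-identityʳ _ ⟨
      V s + 0#             ≈⟨ +-congˡ D-last ⟨
      V s + D s (suc M)    ≈⟨ ∑-telescope _ _ (D s) (V-step s) (suc M) ⟩
      ∑ (suc M) _ + D s 0  ≈⟨ +-cong (sym (*-∑ _ (suc M) _)) D-first ⟩
      (1# + a * q ^ suc (s ℕ.+ m)) * V (suc s) + 0#  ≈⟨ +-identityʳ _ ⟩
      (1# + a * q ^ suc (s ℕ.+ m)) * V (suc s)       ∎
      where
      D-last : D s (suc M) ≈ 0#
      D-last = trans (*-congˡ (trans (*-congʳ (τ≥M (ℕₚ.≤-trans (ℕₚ.n≤1+n M) (ℕₚ.m≤n+m (suc M) m))))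
                                     (zeroˡ _))) (zeroʳ _)
      D-first : D s 0 ≈ 0#
      D-first = trans (*-congˡ (trans (*-congˡ (zeroˡ _)) (zeroʳ _))) (zeroʳ _)

    -- The product of the factors is (-aq)_{s+m}/(-aq)_m; keeping the denominator on the left avoids
    -- a quotient.
    V-iterate : ∀ s → aqPoch m * V 0 ≈ aqPoch (s ℕ.+ m) * V s
    V-iterate zero    = refl
    V-iterate (suc s) = begin
      aqPoch m * V 0               ≈⟨ V-iterate s ⟩
      aqPoch (s ℕ.+ m) * V s       ≈⟨ *-congˡ (V-rec s) ⟩
      aqPoch (s ℕ.+ m) * (_ * V (suc s))
        ≈⟨ solve 3 (λ x y z → x :* (y :* z) := y :* x :* z) refl _ _ _ ⟩
      aqPoch (suc s ℕ.+ m) * V (suc s) ∎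

    -- At s = M the power q^{Mt} kills all terms with t > 0, so s = M already plays the part of the
    -- limit.
    V-limit : V M ≈ τ m * invQPoch M
    V-limit = begin
      V M                              ≈⟨ ∑-head M _ ⟩
      V-term M 0 + ∑ M (λ t → V-term M (suc t))
        ≈⟨ +-cong first (∑-zero M (λ t _ → trans (*-congʳ (q^≥M (ℕₚ.m≤m*n M (suc t)))) (zeroˡ _))) ⟩
      τ m * invQPoch M + 0#              ≈⟨ +-identityʳ _ ⟩
      τ m * invQPoch M                   ∎
      where
      first : V-term M 0 ≈ τ m * invQPoch M
      first = begin
        q ^ (M ℕ.* 0) * (τ (m ℕ.+ 0) * (1# * invQPoch (M ℕ.+ 0 ℕ.+ (m ℕ.+ m))))
          ≡⟨ ≡.cong₂ (λ x y → q ^ x * (τ y * (1# * invQPoch (M ℕ.+ 0 ℕ.+ (m ℕ.+ m)))))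
               (ℕₚ.*-zeroʳ M) (ℕₚ.+-identityʳ m) ⟩
        1# * (τ m * (1# * invQPoch (M ℕ.+ 0 ℕ.+ (m ℕ.+ m))))
          ≈⟨ solve 2 (λ x y → con 1 :* (x :* (con 1 :* y)) := x :* y) refl _ _ ⟩
        τ m * invQPoch (M ℕ.+ 0 ℕ.+ (m ℕ.+ m))
          ≡⟨ ≡.cong (λ l → τ m * invQPoch l) (≡.trans (≡.cong (ℕ._+ (m ℕ.+ m)) (ℕₚ.+-identityʳ M))
                                                     (ℕₚ.+-comm M (m ℕ.+ m))) ⟩
        τ m * invQPoch (m ℕ.+ m ℕ.+ M)    ≈⟨ *-congˡ (invQPoch-stable (m ℕ.+ m) (ℕₚ.n≤1+n M)) ⟩
        τ m * invQPoch M ∎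

    peakSum : Carrier
    peakSum = ∑ (suc M) (λ N → τ N * c N m)

    -- The substitution N = m + t. The terms with N < m vanish through 1/(q)_{N-m}, and those added
    -- above M through `τ`.
    peakSum-V : peakSum ≈ V 0
    peakSum-V = begin
      ∑ (suc M) F                                     ≈⟨ +-identityʳ _ ⟨
      ∑ (suc M) F + 0#
        ≈⟨ +-congˡ (∑-zero m (λ j _ → trans (*-congʳ (τ≥M (ℕₚ.≤-trans (ℕₚ.n≤1+n M) (ℕₚ.m≤m+n (suc M) j)))) (zeroˡ _))) ⟨
      ∑ (suc M) F + ∑ m (λ j → F (suc M ℕ.+ j))       ≈⟨ ∑-split (suc M) m F ⟨
      ∑ (suc M ℕ.+ m) F                               ≡⟨ ≡.cong (λ l → ∑ l F) (ℕₚ.+-comm (suc M) m) ⟩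
      ∑ (m ℕ.+ suc M) F                               ≈⟨ ∑-split m (suc M) F ⟩
      ∑ m F + ∑ (suc M) (λ t → F (m ℕ.+ t))
        ≈⟨ +-congʳ (∑-zero m (λ N N<m → trans (*-congˡ (trans (*-congʳ (invQPochDiff-vanish N<m)) (zeroˡ _))) (zeroʳ _))) ⟩
      0# + ∑ (suc M) (λ t → F (m ℕ.+ t))              ≈⟨ +-identityˡ _ ⟩
      ∑ (suc M) (λ t → F (m ℕ.+ t))                   ≈⟨ ∑-cong (suc M) term ⟩
      V 0                                             ∎
      where
      F : ℕ → Carrier
      F N = τ N * c N m
      term : ∀ t → F (m ℕ.+ t) ≈ V-term 0 t
      term t = trans (reflexive (≡.cong₂ (λ x l → τ (m ℕ.+ t) * (x * invQPoch l)) (invQPochDiff-cancel m t)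
        (NS.solve 2 (λ m t → m NS.:+ t NS.:+ m NS.:= t NS.:+ (m NS.:+ m)) ≡.refl m t)))
        (sym (*-identityˡ _))

    peakSum-value : peakSum ≈ aqPoch M * invQPoch M * (τ m * invAQPoch m)
    peakSum-value = begin
      peakSum                                    ≈⟨ peakSum-V ⟩
      V 0                                        ≈⟨ *-identityˡ _ ⟨
      1# * V 0                                   ≈⟨ *-congʳ (invAQPoch-inverse m) ⟨
      invAQPoch m * aqPoch m * V 0                ≈⟨ *-assoc _ _ _ ⟩
      invAQPoch m * (aqPoch m * V 0)              ≈⟨ *-congˡ (V-iterate M) ⟩
      invAQPoch m * (aqPoch (M ℕ.+ m) * V M)
        ≈⟨ *-congˡ (*-cong (trans (reflexive (≡.cong aqPoch (ℕₚ.+-comm M m))) (aqPoch-stable m (ℕₚ.n≤1+n M))) V-limit) ⟩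
      invAQPoch m * (aqPoch M * (τ m * invQPoch M))
        ≈⟨ solve 4 (λ i a t r → i :* (a :* (t :* r)) := a :* r :* (t :* i)) refl _ _ _ _ ⟩
      aqPoch M * invQPoch M * (τ m * invAQPoch m)   ∎

  open PeakSum using (peakSum; peakSum-value)

  -- The recurrences in the height and their solution

  module Paths (h : ℕ) where

    -- This is 2k - 1, twice the quadratic coefficient of kn² - n(n-1)/2. In terms of `triangle` the
    -- exponents thus need neither halves nor subtraction.
    κ : ℕ
    κ = suc (h ℕ.+ h)

    -- (-1)^n q^{kn² - n(n-1)/2 + n(y-1)} with k = h + 1, for n = m in A⁺ m y and for
    -- n = -(m + 1) in A⁻ m i, where i = k - y keeps the exponent a natural number.
    A⁺ A⁻ : ℕ → ℕ → Carrier
    A⁺ m y = sign m * q ^ (κ ℕ.* triangle m ℕ.+ (h ℕ.+ y) ℕ.* m)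
    A⁻ m i = sign (suc m) * q ^ (κ ℕ.* triangle (suc m) ℕ.+ i ℕ.* suc m)

    A-step : ∀ s x {n n′} → n ≡ x ℕ.+ n′ → s * q ^ n ≈ q ^ x * (s * q ^ n′)
    A-step s x {n} {n′} p = begin
      s * q ^ n               ≡⟨ ≡.cong (λ l → s * q ^ l) p ⟩
      s * q ^ (x ℕ.+ n′)      ≈⟨ *-congˡ (^-homo-* q x n′) ⟩
      s * (q ^ x * q ^ n′)    ≈⟨ solve 3 (λ x y z → x :* (y :* z) := y :* (x :* z)) refl _ _ _ ⟩
      q ^ x * (s * q ^ n′)    ∎

    A⁺-suc : ∀ m y → A⁺ m (suc y) ≈ q ^ m * A⁺ m y
    A⁺-suc m y = A-step (sign m) m (NS.solve 4 (λ k h y m →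
      k NS.:+ (h NS.:+ (NS.con 1 NS.:+ y)) NS.:* m NS.:= m NS.:+ (k NS.:+ (h NS.:+ y) NS.:* m))
      ≡.refl (κ ℕ.* triangle m) h y m)

    A⁻-suc : ∀ m i → A⁻ m (suc i) ≈ q ^ suc m * A⁻ m i
    A⁻-suc m i = A-step (sign (suc m)) (suc m) (NS.solve 3 (λ k i m →
      k NS.:+ (NS.con 1 NS.:+ i) NS.:* m NS.:= m NS.:+ (k NS.:+ i NS.:* m))
      ≡.refl (κ ℕ.* triangle (suc m)) i (suc m))

    -- The recurrence for f_y, one summand at a time and without the common factor `u`. For n = m it
    -- comes from 1/(q)_{N+1-m}. For n = -(m+1), treated next, the two q-factorials exchange roles
    -- and it comes from 1/(q)_{N+m+2}.
    A⁺c-suc : ∀ m y N → A⁺ m (suc y) * c (suc N) m ≈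
                        A⁺ m (suc y) * d N m + q ^ suc N * (A⁺ m y * c (suc N) m)
    A⁺c-suc m y N = begin
      A⁺ m (suc y) * (X * W)   ≈⟨ *-congʳ (A⁺-suc m y) ⟩
      Q * α * (X * W)
        ≈⟨ solve 4 (λ Q α X W → Q :* α :* (X :* W) := α :* W :* (Q :* X)) refl _ _ _ _ ⟩
      α * W * (Q * X)          ≈⟨ *-congˡ (invQPochDiff-suc N m) ⟩
      α * W * (Q * Z + Q′ * X)
        ≈⟨ solve 6 (λ Q Q′ α X Z W → α :* W :* (Q :* Z :+ Q′ :* X)
                     := Q :* α :* (Z :* W) :+ Q′ :* (α :* (X :* W))) refl Q Q′ α X Z W ⟩
      Q * α * (Z * W) + Q′ * (α * (X * W)) ≈⟨ +-congʳ (*-congʳ (A⁺-suc m y)) ⟨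
      A⁺ m (suc y) * (Z * W) + Q′ * (α * (X * W)) ∎
      where
      α = A⁺ m y ; Q = q ^ m ; Q′ = q ^ suc N
      X = invQPochDiff (suc N) m ; Z = invQPochDiff N m ; W = invQPoch (suc (N ℕ.+ m))

    A⁻c-suc : ∀ m i N → A⁻ m i * c (suc N) (suc m) ≈
                        A⁻ m i * d N m + q ^ suc N * (A⁻ m (suc i) * c (suc N) (suc m))
    A⁻c-suc m i N = begin
      α * (Z * V)                   ≈⟨ *-congˡ (*-congˡ V-rec) ⟩
      α * (Z * (W + Q′ * Q * V))
        ≈⟨ solve 6 (λ Q Q′ α Z W V → α :* (Z :* (W :+ Q′ :* Q :* V))
                     := α :* (Z :* W) :+ Q′ :* (Q :* α :* (Z :* V))) refl Q Q′ α Z W V ⟩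
      α * (Z * W) + Q′ * (Q * α * (Z * V))  ≈⟨ +-congˡ (*-congˡ (*-congʳ (A⁻-suc m i))) ⟨
      α * (Z * W) + Q′ * (A⁻ m (suc i) * (Z * V)) ∎
      where
      α = A⁻ m i ; Q = q ^ suc m ; Q′ = q ^ suc N
      Z = invQPochDiff N m ; W = invQPoch (suc (N ℕ.+ m)) ; V = invQPoch (suc N ℕ.+ suc m)
      V-rec : V ≈ W + Q′ * Q * V
      V-rec = begin
        V  ≈⟨ invQPoch-suc (N ℕ.+ suc m) ⟩
        invQPoch (N ℕ.+ suc m) + q ^ (suc N ℕ.+ suc m) * V
          ≈⟨ +-cong (reflexive (≡.cong invQPoch (ℕₚ.+-suc N m))) (*-congʳ (^-homo-* q (suc N) (suc m))) ⟩
        W + Q′ * Q * V ∎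

    -- The recurrence for g_y, one summand at a time. Now n = m uses the factor 1/(q)_{N+m+1}, and n
    -- = -(m+1) uses 1/(q)_{N-m}.
    A⁺d-rec : ∀ m y N → A⁺ m y * d N m ≈
                        A⁺ m y * c N m + q ^ suc N * (A⁺ m (suc y) * d N m)
    A⁺d-rec m y N = begin
      α * (Z * W)                 ≈⟨ *-congˡ (*-congˡ (invQPoch-suc (N ℕ.+ m))) ⟩
      α * (Z * (V + q ^ (suc N ℕ.+ m) * W))
        ≈⟨ *-congˡ (*-congˡ (+-congˡ (*-congʳ (^-homo-* q (suc N) m)))) ⟩
      α * (Z * (V + Q′ * Q * W))
        ≈⟨ solve 6 (λ Q Q′ α Z W V → α :* (Z :* (V :+ Q′ :* Q :* W))
                     := α :* (Z :* V) :+ Q′ :* (Q :* α :* (Z :* W))) refl Q Q′ α Z W V ⟩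
      α * (Z * V) + Q′ * (Q * α * (Z * W))  ≈⟨ +-congˡ (*-congˡ (*-congʳ (A⁺-suc m y))) ⟨
      α * (Z * V) + Q′ * (A⁺ m (suc y) * (Z * W)) ∎
      where
      α = A⁺ m y ; Q = q ^ m ; Q′ = q ^ suc N
      Z = invQPochDiff N m ; W = invQPoch (suc (N ℕ.+ m)) ; V = invQPoch (N ℕ.+ m)

    A⁻d-rec : ∀ m i N → A⁻ m (suc i) * d N m ≈
                        A⁻ m (suc i) * c N (suc m) + q ^ suc N * (A⁻ m i * d N m)
    A⁻d-rec m i N = begin
      A⁻ m (suc i) * (Z * W)   ≈⟨ *-congʳ (A⁻-suc m i) ⟩
      Q * α * (Z * W)
        ≈⟨ solve 4 (λ Q α X W → Q :* α :* (X :* W) := α :* W :* (Q :* X)) refl _ _ _ _ ⟩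
      α * W * (Q * Z)          ≈⟨ *-congˡ (invQPochDiff-suc N (suc m)) ⟩
      α * W * (Q * X + Q′ * Z)
        ≈⟨ solve 6 (λ Q Q′ α X Z W → α :* W :* (Q :* X :+ Q′ :* Z)
                     := Q :* α :* (X :* W) :+ Q′ :* (α :* (Z :* W))) refl Q Q′ α X Z W ⟩
      Q * α * (X * W) + Q′ * (α * (Z * W))
        ≈⟨ +-congʳ (*-cong (A⁻-suc m i) (*-congˡ (reflexive (≡.cong invQPoch (ℕₚ.+-suc N m))))) ⟨
      A⁻ m (suc i) * c N (suc m) + Q′ * (α * (Z * W)) ∎
      where
      α = A⁻ m i ; Q = q ^ suc m ; Q′ = q ^ suc N
      X = invQPochDiff N (suc m) ; Z = invQPochDiff N m ; W = invQPoch (suc (N ℕ.+ m))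

    -- f y i N is f_{y-1}(N), the shift making room for f_{-1}; g y i N is g_y(N+1).  In both, y + i = k.
    f g : ℕ → ℕ → ℕ → Carrier
    f y i N = u N * ∑ (suc M) (λ m → A⁺ m y * c N m + A⁻ m i * c N (suc m))
    g y i N = u N * ∑ (suc M) (λ m → A⁺ m y * d N m + A⁻ m i * d N m)

    combine : ∀ {x x′ y y′ z z′ w} → x ≈ y + w * z → x′ ≈ y′ + w * z′ →
              x + x′ ≈ y + y′ + w * (z + z′)
    combine p r = trans (+-cong p r) (solve 5 (λ y y′ z z′ w →
      y :+ w :* z :+ (y′ :+ w :* z′) := y :+ y′ :+ w :* (z :+ z′)) refl _ _ _ _ _)

    f-suc : ∀ y i N → f (suc y) i (suc N) ≈ q ^ suc N * (g (suc y) i N + f y (suc i) (suc N))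
    f-suc y i N = begin
      u (suc N) * ∑ (suc M) _
        ≈⟨ *-congˡ (∑-linear (suc M) (q ^ suc N)
             (λ m → combine (A⁺c-suc m y N) (A⁻c-suc m i N))) ⟩
      u (suc N) * (G + q ^ suc N * F)
        ≈⟨ solve 4 (λ u Q G F → u :* (G :+ Q :* F) := u :* G :+ Q :* (u :* F)) refl _ _ _ _ ⟩
      u (suc N) * G + q ^ suc N * (u (suc N) * F)
        ≈⟨ +-congʳ (*-congʳ (u-suc N)) ⟩
      q ^ suc N * u N * G + q ^ suc N * (u (suc N) * F)
        ≈⟨ solve 4 (λ Q u G F → Q :* u :* G :+ Q :* F := Q :* (u :* G :+ F)) refl _ _ _ _ ⟩
      q ^ suc N * (u N * G + u (suc N) * F) ∎
      where
      G = ∑ (suc M) (λ m → A⁺ m (suc y) * d N m + A⁻ m i * d N m)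
      F = ∑ (suc M) (λ m → A⁺ m y * c (suc N) m + A⁻ m (suc i) * c (suc N) (suc m))

    g-rec : ∀ y i N → g y (suc i) N ≈ f y (suc i) N + q ^ suc N * g (suc y) i N
    g-rec y i N = begin
      u N * ∑ (suc M) _
        ≈⟨ *-congˡ (∑-linear (suc M) (q ^ suc N)
             (λ m → combine (A⁺d-rec m y N) (A⁻d-rec m i N))) ⟩
      u N * (F + q ^ suc N * G)
        ≈⟨ solve 4 (λ u Q G F → u :* (F :+ Q :* G) := u :* F :+ Q :* (u :* G)) refl _ _ _ _ ⟩
      u N * F + q ^ suc N * (u N * G) ∎
      where
      G = ∑ (suc M) (λ m → A⁺ m (suc y) * d N m + A⁻ m i * d N m)
      F = ∑ (suc M) (λ m → A⁺ m y * c N m + A⁻ m (suc i) * c N (suc m))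

    -- Both halves of the sum have M + 1 terms. Dropping the last negative one leaves exactly the
    -- pairs n, -n and the term n = 0.
    A⁻-M : ∀ i → A⁻ M i ≈ 0#
    A⁻-M i = trans (*-congˡ (q^≥M (ℕₚ.≤-trans (ℕₚ.m≤n+m M (triangle M))
      (ℕₚ.≤-trans (ℕₚ.m≤m+n (triangle (suc M)) ((h ℕ.+ h) ℕ.* triangle (suc M)))
        (ℕₚ.m≤m+n (κ ℕ.* triangle (suc M)) (i ℕ.* suc M)))))) (zeroʳ _)

    f-expand : ∀ y i N → f y i N ≈ u N * (c N 0 + ∑ M (λ m → (A⁺ (suc m) y + A⁻ m i) * c N (suc m)))
    f-expand y i N = *-congˡ (begin
      ∑ (suc M) (λ m → A⁺ m y * c N m + A⁻ m i * c N (suc m))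
        ≈⟨ ∑-+ (suc M) _ _ ⟩
      ∑ (suc M) (λ m → A⁺ m y * c N m) + (∑ M (λ m → A⁻ m i * c N (suc m)) + A⁻ M i * c N (suc M))
        ≈⟨ +-cong (∑-head M _) (+-congˡ (trans (*-congʳ (A⁻-M i)) (zeroˡ _))) ⟩
      A⁺ 0 y * c N 0 + X + (Y + 0#)
        ≈⟨ +-cong (+-congʳ (trans (*-congʳ A⁺-zero) (*-identityˡ _))) (+-identityʳ _) ⟩
      c N 0 + X + Y
        ≈⟨ +-assoc _ _ _ ⟩
      c N 0 + (X + Y)
        ≈⟨ +-congˡ (∑-+ M _ _) ⟨
      c N 0 + ∑ M (λ m → A⁺ (suc m) y * c N (suc m) + A⁻ m i * c N (suc m))
        ≈⟨ +-congˡ (∑-cong M (λ m → distribʳ _ _ _)) ⟨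
      c N 0 + ∑ M (λ m → (A⁺ (suc m) y + A⁻ m i) * c N (suc m)) ∎)
      where
      X = ∑ M (λ m → A⁺ (suc m) y * c N (suc m))
      Y = ∑ M (λ m → A⁻ m i * c N (suc m))
      A⁺-zero : A⁺ 0 y ≈ 1#
      A⁺-zero = trans (*-identityˡ _) (^-congʳ q (≡.cong₂ ℕ._+_ (ℕₚ.*-zeroʳ κ) (ℕₚ.*-zeroʳ (h ℕ.+ y))))

    -- `A⁺ (suc m) y` and `A⁻ m (h + y)` agree by definition, so going from y = 0 to y = 1 only
    -- exchanges the two coefficients of each pair n, -n.
    f-reflect : ∀ N → f 0 (suc h) N ≈ f 1 h N
    f-reflect N = begin
      f 0 (suc h) N   ≈⟨ f-expand 0 (suc h) N ⟩
      u N * (c N 0 + ∑ M (λ m → (A⁻ m (h ℕ.+ 0) + A⁻ m (suc h)) * c N (suc m)))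
        ≈⟨ *-congˡ (+-congˡ (∑-cong M (λ m → *-congʳ (trans (+-comm _ _) (+-cong
             (reflexive (≡.cong (A⁻ m) (≡.sym (ℕₚ.+-comm h 1))))
             (reflexive (≡.cong (A⁻ m) (ℕₚ.+-identityʳ h)))))))) ⟩
      u N * (c N 0 + ∑ M (λ m → (A⁻ m (h ℕ.+ 1) + A⁻ m h) * c N (suc m)))
                      ≈⟨ f-expand 1 h N ⟨
      f 1 h N         ∎

    -- At height k the summands for n = m and n = -1-m have equal exponents and opposite signs, and
    -- they share `d N m`.
    g-top : ∀ N → g (suc h) 0 N ≈ 0#
    g-top N = trans (*-congˡ (∑-zero (suc M) (λ m _ → begin
      A⁺ m (suc h) * d N m + A⁻ m 0 * d N m                 ≈⟨ distribʳ _ _ _ ⟨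
      (A⁺ m (suc h) + A⁻ m 0) * d N m                       ≈⟨ *-congʳ (+-congʳ (*-congˡ (^-congʳ q (exponent m)))) ⟩
      (sign m * q ^ κΔ m + - sign m * q ^ κΔ m) * d N m       ≈⟨ *-congʳ (distribʳ _ _ _) ⟨
      (sign m + - sign m) * q ^ κΔ m * d N m                 ≈⟨ *-congʳ (trans (*-congʳ (-‿inverseʳ _)) (zeroˡ _)) ⟩
      0# * d N m                                            ≈⟨ zeroˡ _ ⟩
      0#                                                    ∎))) (zeroʳ _)
      where
      κΔ : ℕ → ℕ
      κΔ m = κ ℕ.* triangle (suc m) ℕ.+ 0 ℕ.* suc m
      exponent : ∀ m → κ ℕ.* triangle m ℕ.+ (h ℕ.+ suc h) ℕ.* m ≡ κΔ m
      exponent m = NS.solve 3 (λ h t m →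
        (NS.con 1 NS.:+ (h NS.:+ h)) NS.:* t NS.:+ (h NS.:+ (NS.con 1 NS.:+ h)) NS.:* m
        NS.:= (NS.con 1 NS.:+ (h NS.:+ h)) NS.:* (t NS.:+ m) NS.:+ NS.con 0) ≡.refl h (triangle m) m

    f-zero : ∀ y i → f y i 0 ≈ 1#
    f-zero y i = begin
      f y i 0                             ≈⟨ f-expand y i 0 ⟩
      1# * (1# * 1# + ∑ M _)              ≈⟨ *-congˡ (+-congˡ (∑-zero M (λ m _ → trans (*-congˡ (zeroˡ _)) (zeroʳ _)))) ⟩
      1# * (1# * 1# + 0#)                 ≈⟨ solve 0 (con 1 :* (con 1 :* con 1 :+ con 0) := con 1) refl ⟩
      1#                                  ∎

    -- The generating functions of paths whose first vertex has abscissa x.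
    Φ Ψ : ℕ → ℕ → ℕ → Carrier
    Φ y i x = ∑ (suc M) (λ N → q ^ (x ℕ.* N) * (P N * f y i N))
    Ψ y i x = ∑ M (λ N → q ^ (x ℕ.* suc N) * (P (suc N) * g y i N))

    -- The factor q^N in the recurrence for f_y turns abscissa x into x + 1. The term N = 0 is split
    -- off: there both values of `f` are 1 and `Ψ` contributes nothing.
    Φ-rec : ∀ y i x → Φ (suc y) i x ≈ Ψ (suc y) i (suc x) + Φ y (suc i) (suc x)
    Φ-rec y i x = begin
      Φ (suc y) i x                 ≈⟨ ∑-head M _ ⟩
      H * (1# * f (suc y) i 0) + ∑ M (λ N → q ^ (x ℕ.* suc N) * (P (suc N) * f (suc y) i (suc N)))
        ≈⟨ +-cong (*-congˡ (*-congˡ (trans (f-zero (suc y) i) (sym (f-zero y (suc i))))))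
                  (trans (∑-cong M term) (∑-+ M _ _)) ⟩
      H * (1# * f y (suc i) 0) + (Ψ (suc y) i (suc x) + ∑ M _)
        ≈⟨ solve 3 (λ x y z → x :+ (y :+ z) := y :+ (x :+ z)) refl _ _ _ ⟩
      Ψ (suc y) i (suc x) + (H * (1# * f y (suc i) 0) + ∑ M _)
        ≈⟨ +-congˡ (∑-head M _) ⟨
      Ψ (suc y) i (suc x) + Φ y (suc i) (suc x) ∎
      where
      H = q ^ (x ℕ.* 0)
      term : ∀ N → q ^ (x ℕ.* suc N) * (P (suc N) * f (suc y) i (suc N)) ≈
        q ^ (suc x ℕ.* suc N) * (P (suc N) * g (suc y) i N)
        + q ^ (suc x ℕ.* suc N) * (P (suc N) * f y (suc i) (suc N))
      term N = begin
        X * (P (suc N) * f (suc y) i (suc N))   ≈⟨ *-congˡ (*-congˡ (f-suc y i N)) ⟩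
        X * (P (suc N) * (q ^ suc N * (g (suc y) i N + f y (suc i) (suc N))))
          ≈⟨ solve 5 (λ X P Q g f → X :* (P :* (Q :* (g :+ f))) := Q :* X :* (P :* g) :+ Q :* X :* (P :* f))
               refl _ _ _ _ _ ⟩
        q ^ suc N * X * (P (suc N) * g (suc y) i N) + q ^ suc N * X * (P (suc N) * f y (suc i) (suc N))
          ≈⟨ +-cong (*-congʳ (^-homo-* q (suc N) (x ℕ.* suc N))) (*-congʳ (^-homo-* q (suc N) (x ℕ.* suc N))) ⟨
        _ ∎
        where X = q ^ (x ℕ.* suc N)

    -- The last factor a + q^N of `P (suc N)` separates the two ways down from a peak at x: a for
    -- South, q^N for South-East, which moves the N remaining peaks.
    Ψ-rec : ∀ y i x → Ψ y (suc i) x ≈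
            Ψ (suc y) i (suc x) + q ^ x * (Φ y (suc i) (suc x) + a * Φ y (suc i) x)
    Ψ-rec y i x = begin
      Ψ y (suc i) x     ≈⟨ ∑-linear M (q ^ x) term ⟩
      Ψ (suc y) i (suc x) + q ^ x * ∑ M _
        ≈⟨ +-congˡ (*-congˡ (∑-linear M a (λ _ → refl))) ⟩
      Ψ (suc y) i (suc x) + q ^ x * (∑ M (Φ-term (suc x)) + a * ∑ M (Φ-term x))
        ≈⟨ +-congˡ (*-congˡ (+-cong (last (suc x)) (*-congˡ (last x)))) ⟩
      Ψ (suc y) i (suc x) + q ^ x * (Φ y (suc i) (suc x) + a * Φ y (suc i) x) ∎
      where
      Φ-term : ℕ → ℕ → Carrier
      Φ-term x N = q ^ (x ℕ.* N) * (P N * f y (suc i) N)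
      -- `Φ` has one term more than `Ψ`, at N = M, and it vanishes with `u M`.
      last : ∀ x → ∑ M (Φ-term x) ≈ Φ y (suc i) x
      last x = sym (trans (+-congˡ (trans (*-congˡ (trans (*-congˡ (trans (*-congʳ (u≥M ℕₚ.≤-refl)) (zeroˡ _)))
                                                          (zeroʳ _))) (zeroʳ _))) (+-identityʳ _))
      term : ∀ N → q ^ (x ℕ.* suc N) * (P (suc N) * g y (suc i) N) ≈
             q ^ (suc x ℕ.* suc N) * (P (suc N) * g (suc y) i N)
             + q ^ x * (Φ-term (suc x) N + a * Φ-term x N)
      term N = begin
        q ^ (x ℕ.* suc N) * (P (suc N) * g y (suc i) N)
          ≈⟨ *-congˡ (*-congˡ (g-rec y i N)) ⟩
        q ^ (x ℕ.* suc N) * (P (suc N) * (F + Q * G))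
          ≈⟨ solve 5 (λ X P F Q G → X :* (P :* (F :+ Q :* G)) := Q :* X :* (P :* G) :+ X :* (P :* F))
               refl _ _ _ _ _ ⟩
        Q * q ^ (x ℕ.* suc N) * (P (suc N) * G) + q ^ (x ℕ.* suc N) * (P (suc N) * F)
          ≈⟨ +-cong (*-congʳ (sym (^-homo-* q (suc N) (x ℕ.* suc N))))
               (*-congʳ (trans (^-congʳ q (ℕₚ.*-suc x N)) (^-homo-* q x (x ℕ.* N)))) ⟩
        q ^ (suc x ℕ.* suc N) * (P (suc N) * G) + q ^ x * X * (P N * (a + q ^ N) * F)
          ≈⟨ +-congˡ (solve 6 (λ Qx X P a QN F → Qx :* X :* (P :* (a :+ QN) :* F)
               := Qx :* (QN :* X :* (P :* F) :+ a :* (X :* (P :* F)))) refl _ _ _ _ _ _) ⟩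
        q ^ (suc x ℕ.* suc N) * (P (suc N) * G) + q ^ x * (q ^ N * X * (P N * F) + a * (X * (P N * F)))
          ≈⟨ +-congˡ (*-congˡ (+-congʳ (*-congʳ (^-homo-* q N (x ℕ.* N))))) ⟨
        _ ∎
        where
        F = f y (suc i) N ; G = g (suc y) i N ; Q = q ^ suc N ; X = q ^ (x ℕ.* N)

    Φ-reflect : ∀ x → Φ 0 (suc h) x ≈ Φ 1 h x
    Φ-reflect x = ∑-cong (suc M) (λ N → *-congˡ (*-congˡ (f-reflect N)))

    Ψ-top : ∀ x → Ψ (suc h) 0 x ≈ 0#
    Ψ-top x = ∑-zero M (λ N _ → trans (*-congˡ (trans (*-congˡ (g-top N)) (zeroʳ _))) (zeroʳ _))

    Φ-large : ∀ y i {x} → M ≤ x → Φ y i x ≈ 1#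
    Φ-large y i {x} M≤x = begin
      Φ y i x        ≈⟨ ∑-head M _ ⟩
      q ^ (x ℕ.* 0) * (1# * f y i 0) + ∑ M _
        ≈⟨ +-cong (*-cong (^-congʳ q (ℕₚ.*-zeroʳ x)) (*-congˡ (f-zero y i)))
             (∑-zero M (λ N _ → trans (*-congʳ (q^≥M (ℕₚ.≤-trans M≤x (ℕₚ.m≤m*n x (suc N))))) (zeroˡ _))) ⟩
      1# * (1# * 1#) + 0#   ≈⟨ solve 0 (con 1 :* (con 1 :* con 1) :+ con 0 := con 1) refl ⟩
      1# ∎

    Ψ-large : ∀ y i {x} → M ≤ x → Ψ y i x ≈ 0#
    Ψ-large y i {x} M≤x = ∑-zero M
      (λ N _ → trans (*-congʳ (q^≥M (ℕₚ.≤-trans M≤x (ℕₚ.m≤m*n x (suc N))))) (zeroˡ _))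

    -- Interchanging the sums over N and n leaves one `peakSum` for each n, taken at |n|.
    Φ-closed : ∀ y i → Φ y i 0 ≈ aqPoch M * invQPoch M *
      ∑ (suc M) (λ m → A⁺ m y * (τ m * invAQPoch m) + A⁻ m i * (τ (suc m) * invAQPoch (suc m)))
    Φ-closed y i = begin
      Φ y i 0     ≈⟨ ∑-cong (suc M) (λ N → trans (expand N) (*-∑ (τ N) (suc M) _)) ⟩
      ∑ (suc M) (λ N → ∑ (suc M) (λ m → τ N * (A⁺ m y * c N m + A⁻ m i * c N (suc m))))
        ≈⟨ ∑-swap (suc M) (suc M) _ ⟩
      ∑ (suc M) (λ m → ∑ (suc M) (λ N → τ N * (A⁺ m y * c N m + A⁻ m i * c N (suc m))))
        ≈⟨ ∑-cong (suc M) (λ m → trans (∑-cong (suc M) (λ N →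
             solve 5 (λ t A c B c′ → t :* (A :* c :+ B :* c′) := A :* (t :* c) :+ B :* (t :* c′))
               refl (τ N) (A⁺ m y) (c N m) (A⁻ m i) (c N (suc m))))
             (∑-+ (suc M) _ _)) ⟩
      ∑ (suc M) (λ m → ∑ (suc M) (λ N → A⁺ m y * (τ N * c N m))
                       + ∑ (suc M) (λ N → A⁻ m i * (τ N * c N (suc m))))
        ≈⟨ ∑-cong (suc M) (λ m → +-cong (*-∑ (A⁺ m y) (suc M) _) (*-∑ (A⁻ m i) (suc M) _)) ⟨
      ∑ (suc M) (λ m → A⁺ m y * peakSum m + A⁻ m i * peakSum (suc m))
        ≈⟨ ∑-cong (suc M) (λ m → trans
             (+-cong (*-congˡ (peakSum-value m)) (*-congˡ (peakSum-value (suc m))))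
             (solve 5 (λ Z A t B t′ → A :* (Z :* t) :+ B :* (Z :* t′) := Z :* (A :* t :+ B :* t′)) refl
               (aqPoch M * invQPoch M) _ _ _ _)) ⟩
      ∑ (suc M) (λ m → aqPoch M * invQPoch M *
        (A⁺ m y * (τ m * invAQPoch m) + A⁻ m i * (τ (suc m) * invAQPoch (suc m))))
        ≈⟨ *-∑ _ (suc M) _ ⟨
      _ ∎
      where
      expand : ∀ N → q ^ 0 * (P N * f y i N) ≈
               τ N * ∑ (suc M) (λ m → A⁺ m y * c N m + A⁻ m i * c N (suc m))
      expand N = solve 3 (λ P u s → con 1 :* (P :* (u :* s)) := u :* P :* s) refl _ _ _

    -- Weighted sums over words and removal of the first step

    listSum : (List Step → Carrier) → List (List Step) → Carrier
    listSum φ []       = 0#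
    listSum φ (w ∷ ws) = φ w + listSum φ ws

    listSum-cong : ∀ {φ ψ} ws → (∀ w → φ w ≈ ψ w) → listSum φ ws ≈ listSum ψ ws
    listSum-cong []       p = refl
    listSum-cong (w ∷ ws) p = +-cong (p w) (listSum-cong ws p)

    listSum-zero : ∀ ws → listSum (λ _ → 0#) ws ≈ 0#
    listSum-zero []       = refl
    listSum-zero (w ∷ ws) = trans (+-identityˡ _) (listSum-zero ws)

    listSum-+ : ∀ φ ψ ws → listSum (λ w → φ w + ψ w) ws ≈ listSum φ ws + listSum ψ ws
    listSum-+ φ ψ []       = sym (+-identityˡ _)
    listSum-+ φ ψ (w ∷ ws) = trans (+-congˡ (listSum-+ φ ψ ws)) (interchange _ _ _ _)

    listSum-* : ∀ x φ ws → listSum (λ w → x * φ w) ws ≈ x * listSum φ ws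
    listSum-* x φ []       = sym (zeroʳ x)
    listSum-* x φ (w ∷ ws) = trans (+-congˡ (listSum-* x φ ws)) (sym (distribˡ _ _ _))

    listSum-++ : ∀ φ ws vs → listSum φ (ws ++ vs) ≈ listSum φ ws + listSum φ vs
    listSum-++ φ []       vs = sym (+-identityˡ _)
    listSum-++ φ (w ∷ ws) vs = trans (+-congˡ (listSum-++ φ ws vs)) (sym (+-assoc _ _ _))

    prepend : (List Step → Carrier) → List Step → Carrier
    prepend φ w = φ (NE ∷ w) + (φ (SE ∷ w) + (φ (S ∷ w) + φ (E ∷ w)))

    listSum-wordsOf : ∀ φ L → listSum φ (wordsOf (suc L)) ≈ listSum (prepend φ) (wordsOf L)
    listSum-wordsOf φ L = go (wordsOf L)
      where
      go : ∀ ws → listSum φ (concatMap (λ w → (NE ∷ w) ∷ (SE ∷ w) ∷ (S ∷ w) ∷ (E ∷ w) ∷ []) ws) ≈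
                  listSum (prepend φ) ws
      go []       = refl
      go (w ∷ ws) = trans
        (+-congˡ (+-congˡ (+-congˡ (+-congˡ (go ws)))))
        (solve 5 (λ x y z t r → x :+ (y :+ (z :+ (t :+ r))) := x :+ (y :+ (z :+ t)) :+ r) refl _ _ _ _ _)

    -- A nonempty word of length at most L + 1 is a step followed by a word of length at most L. As
    -- `wordsUpTo` groups words by length, this takes the inner induction `shift`.
    listSum-wordsUpTo : ∀ φ L → listSum φ (wordsUpTo (suc L)) ≈
                                φ [] + listSum (prepend φ) (wordsUpTo L)
    listSum-wordsUpTo φ L = begin
      listSum φ (wordsOf (suc L) ++ wordsUpTo L)                ≈⟨ listSum-++ φ (wordsOf (suc L)) _ ⟩
      listSum φ (wordsOf (suc L)) + listSum φ (wordsUpTo L)     ≈⟨ +-congʳ (listSum-wordsOf φ L) ⟩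
      listSum (prepend φ) (wordsOf L) + listSum φ (wordsUpTo L) ≈⟨ shift L ⟩
      φ [] + listSum (prepend φ) (wordsUpTo L)                  ∎
      where
      shift : ∀ L → listSum (prepend φ) (wordsOf L) + listSum φ (wordsUpTo L) ≈
                    φ [] + listSum (prepend φ) (wordsUpTo L)
      shift zero    = solve 2 (λ x y → x :+ con 0 :+ (y :+ con 0) := y :+ (x :+ con 0)) refl _ _
      shift (suc L) = begin
        X + listSum φ (wordsUpTo (suc L))          ≈⟨ +-congˡ (listSum-wordsUpTo φ L) ⟩
        X + (φ [] + Y)                             ≈⟨ solve 3 (λ x y z → x :+ (y :+ z) := y :+ (x :+ z)) refl _ _ _ ⟩
        φ [] + (X + Y)                             ≈⟨ +-congˡ (listSum-++ (prepend φ) (wordsOf (suc L)) _) ⟨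
        φ [] + listSum (prepend φ) (wordsUpTo (suc L)) ∎
        where
        X = listSum (prepend φ) (wordsOf (suc L))
        Y = listSum (prepend φ) (wordsUpTo L)

    weight : ℕ → Bool → ℕ → List Step → Carrier
    weight y b x w = if walk (suc h) y b w ∧ endsDown w
                     then q ^ majorFrom x b w * a ^ southSteps w else 0#

    W : ℕ → ℕ → Bool → ℕ → Carrier
    W L y b x = listSum (weight y b x) (wordsUpTo L)

    -- `endsDown` rejects the one-letter word NE and accepts its empty tail, but both have weight 0
    -- because they end above height 0.
    weight-NE : ∀ y b x w → weight y b x (NE ∷ w) ≈
                            (if suc y <ᵇ suc h then weight (suc y) true (suc x) w else 0#)
    weight-NE y b x w with suc y <ᵇ suc h
    weight-NE y b x []      | true  = refl
    weight-NE y b x (_ ∷ _) | true  = refl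
    weight-NE y b x w       | false = refl

    weight-SE : ∀ y x w → weight (suc y) false x (SE ∷ w) ≈ weight y false (suc x) w
    weight-SE y x []      = refl
    weight-SE y x (_ ∷ _) = refl

    -- The common form of both descents from a peak at x: s is the weight of the step itself, 1 for
    -- South-East and a for South.
    weight-peak : ∀ (p : Bool) x y z {r s t} → z ≡ x ℕ.+ y → r ≈ s * t →
                  (if p then q ^ z * r else 0#) ≈ q ^ x * (s * (if p then q ^ y * t else 0#))
    weight-peak true x y z {r} {s} {t} ≡.refl r≈st = begin
      q ^ (x ℕ.+ y) * r             ≈⟨ *-cong (^-homo-* q x y) r≈st ⟩
      q ^ x * q ^ y * (s * t)       ≈⟨ solve 4 (λ x y s t → x :* y :* (s :* t) := x :* (s :* (y :* t))) refl _ _ _ _ ⟩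
      q ^ x * (s * (q ^ y * t))     ∎
    weight-peak false x y z _ _ = sym (trans (*-congˡ (zeroʳ _)) (zeroʳ _))

    weight-peak-SE : ∀ y x w → weight (suc y) true x (SE ∷ w) ≈ q ^ x * weight y false (suc x) w
    weight-peak-SE y x w = trans (lemma w) (*-congˡ (*-identityˡ _))
      where
      lemma : ∀ w → weight (suc y) true x (SE ∷ w) ≈ q ^ x * (1# * weight y false (suc x) w)
      lemma []           = weight-peak _ x _ _ ≡.refl (sym (*-identityˡ _))
      lemma w@(_ ∷ _) = weight-peak _ x _ _ ≡.refl (sym (*-identityˡ _))

    weight-peak-S : ∀ y x w → weight (suc y) true x (S ∷ w) ≈ q ^ x * (a * weight y false x w)
    weight-peak-S y x []           = weight-peak _ x _ _ ≡.refl refl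
    weight-peak-S y x w@(_ ∷ _) = weight-peak _ x _ _ ≡.refl refl

    -- Corrects for the word E, which is excluded although its tail, the empty word, is not.
    emptyWord : List Step → Carrier
    emptyWord []      = 1#
    emptyWord (_ ∷ _) = 0#

    weight-E : ∀ x w → weight 0 false x (E ∷ w) + emptyWord w ≈ weight 0 false (suc x) w
    weight-E x []      = trans (+-identityˡ _) (sym (*-identityˡ _))
    weight-E x (_ ∷ _) = +-identityʳ _

    listSum-emptyWord : ∀ L → listSum emptyWord (wordsUpTo L) ≈ 1#
    listSum-emptyWord zero    = +-identityʳ _
    listSum-emptyWord (suc L) = begin
      listSum emptyWord (wordsUpTo (suc L))   ≈⟨ listSum-wordsUpTo emptyWord L ⟩
      1# + listSum (λ _ → 0# + (0# + (0# + 0#))) (wordsUpTo L)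
        ≈⟨ +-congˡ (trans (listSum-cong (wordsUpTo L) (λ _ →
             solve 0 (con 0 :+ (con 0 :+ (con 0 :+ con 0)) := con 0) refl)) (listSum-zero (wordsUpTo L))) ⟩
      1# + 0#                                 ≈⟨ +-identityʳ _ ⟩
      1#                                      ∎

    W-NE : ℕ → ℕ → ℕ → Carrier
    W-NE L y x = if suc y <ᵇ suc h then W L (suc y) true (suc x) else 0#

    listSum-NE : ∀ L y b x → listSum (λ w → weight y b x (NE ∷ w)) (wordsUpTo L) ≈ W-NE L y x
    listSum-NE L y b x = trans (listSum-cong (wordsUpTo L) (weight-NE y b x)) (pull (suc y <ᵇ suc h))
      where
      pull : ∀ p → listSum (λ w → if p then weight (suc y) true (suc x) w else 0#) (wordsUpTo L) ≈
                   (if p then W L (suc y) true (suc x) else 0#)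
      pull true  = refl
      pull false = listSum-zero (wordsUpTo L)

    W-zero : ∀ L x → W (suc L) 0 false x ≈ W-NE L 0 x + W L 0 false (suc x)
    W-zero L x = begin
      W (suc L) 0 false x    ≈⟨ listSum-wordsUpTo _ L ⟩
      1# * 1# + listSum _ (wordsUpTo L)
        ≈⟨ +-congˡ (trans (listSum-cong (wordsUpTo L) (λ w →
             solve 2 (λ x y → x :+ (con 0 :+ (con 0 :+ y)) := x :+ y) refl _ _))
             (listSum-+ _ _ (wordsUpTo L))) ⟩
      1# * 1# + (listSum (λ w → weight 0 false x (NE ∷ w)) (wordsUpTo L) + X)
        ≈⟨ +-congˡ (+-congʳ (listSum-NE L 0 false x)) ⟩
      1# * 1# + (W-NE L 0 x + X)
        ≈⟨ solve 2 (λ x y → con 1 :* con 1 :+ (x :+ y) := x :+ (y :+ con 1)) refl _ _ ⟩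
      W-NE L 0 x + (X + 1#)
        ≈⟨ +-congˡ (+-congˡ (listSum-emptyWord L)) ⟨
      W-NE L 0 x + (X + listSum emptyWord (wordsUpTo L))
        ≈⟨ +-congˡ (listSum-+ _ _ (wordsUpTo L)) ⟨
      W-NE L 0 x + listSum (λ w → weight 0 false x (E ∷ w) + emptyWord w) (wordsUpTo L)
        ≈⟨ +-congˡ (listSum-cong (wordsUpTo L) (weight-E x)) ⟩
      W-NE L 0 x + W L 0 false (suc x) ∎
      where X = listSum (λ w → weight 0 false x (E ∷ w)) (wordsUpTo L)

    W-suc-false : ∀ L y x → W (suc L) (suc y) false x ≈ W-NE L (suc y) x + W L y false (suc x)
    W-suc-false L y x = begin
      W (suc L) (suc y) false x    ≈⟨ listSum-wordsUpTo _ L ⟩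
      0# + listSum _ (wordsUpTo L) ≈⟨ +-identityˡ _ ⟩
      listSum _ (wordsUpTo L)
        ≈⟨ trans (listSum-cong (wordsUpTo L) (λ w →
             solve 2 (λ x y → x :+ (y :+ (con 0 :+ con 0)) := x :+ y) refl _ _))
             (listSum-+ _ _ (wordsUpTo L)) ⟩
      listSum (λ w → weight (suc y) false x (NE ∷ w)) (wordsUpTo L)
        + listSum (λ w → weight (suc y) false x (SE ∷ w)) (wordsUpTo L)
        ≈⟨ +-cong (listSum-NE L (suc y) false x) (listSum-cong (wordsUpTo L) (weight-SE y x)) ⟩
      W-NE L (suc y) x + W L y false (suc x) ∎

    W-suc-true : ∀ L y x → W (suc L) (suc y) true x ≈
                 W-NE L (suc y) x + q ^ x * (W L y false (suc x) + a * W L y false x)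
    W-suc-true L y x = begin
      W (suc L) (suc y) true x     ≈⟨ listSum-wordsUpTo _ L ⟩
      0# + listSum _ (wordsUpTo L) ≈⟨ +-identityˡ _ ⟩
      listSum _ (wordsUpTo L)
        ≈⟨ trans (listSum-cong (wordsUpTo L) (λ w → +-congˡ (begin
             _ ≈⟨ solve 2 (λ y z → y :+ (z :+ con 0) := y :+ z) refl _ _ ⟩
             _ ≈⟨ +-cong (weight-peak-SE y x w) (weight-peak-S y x w) ⟩
             _ ≈⟨ distribˡ _ _ _ ⟨
             q ^ x * (weight y false (suc x) w + a * weight y false x w) ∎)))
             (listSum-+ _ _ (wordsUpTo L)) ⟩
      listSum (λ w → weight (suc y) true x (NE ∷ w)) (wordsUpTo L)
        + listSum (λ w → q ^ x * (weight y false (suc x) w + a * weight y false x w)) (wordsUpTo L)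
        ≈⟨ +-cong (listSum-NE L (suc y) true x) (trans (listSum-* _ _ (wordsUpTo L))
             (*-congˡ (trans (listSum-+ _ _ (wordsUpTo L)) (+-congˡ (listSum-* a _ (wordsUpTo L)))))) ⟩
      W-NE L (suc y) x + q ^ x * (W L y false (suc x) + a * W L y false x) ∎

    -- A path that has just gone up must turn down at some peak, whose abscissa is at least M.
    W-large-true : ∀ L y {x} → M ≤ x → W L (suc y) true x ≈ 0#
    W-NE-large   : ∀ L y {x} → M ≤ x → W-NE L y x ≈ 0#
    W-large-true zero    y     M≤x = +-identityˡ _
    W-large-true (suc L) y {x} M≤x = begin
      W (suc L) (suc y) true x   ≈⟨ W-suc-true L y x ⟩
      W-NE L (suc y) x + q ^ x * _
        ≈⟨ +-cong (W-NE-large L (suc y) M≤x) (trans (*-congʳ (q^≥M M≤x)) (zeroˡ _)) ⟩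
      0# + 0#                    ≈⟨ +-identityˡ _ ⟩
      0#                         ∎
    W-NE-large L y M≤x with suc y <ᵇ suc h
    ... | true  = W-large-true L y (ℕₚ.m≤n⇒m≤1+n M≤x)
    ... | false = refl

    -- The one surviving path consists of y South-East steps, hence the bound y ≤ L. It cannot go on
    -- along the axis, since no path ends with an East step.
    W-large-false : ∀ L y {x} → M ≤ x → y ≤ L → W L y false x ≈ 1#
    W-large-false zero    zero    M≤x y≤L = trans (+-identityʳ _) (*-identityˡ _)
    W-large-false (suc L) zero    M≤x y≤L = trans (W-zero L _)
      (trans (+-cong (W-NE-large L 0 M≤x) (W-large-false L 0 (ℕₚ.m≤n⇒m≤1+n M≤x) z≤n)) (+-identityˡ _))
    W-large-false (suc L) (suc y) M≤x (s≤s y≤L) = trans (W-suc-false L y _)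
      (trans (+-cong (W-NE-large L (suc y) M≤x) (W-large-false L y (ℕₚ.m≤n⇒m≤1+n M≤x) y≤L)) (+-identityˡ _))

    -- A North-East step is forbidden exactly at y = h, that is i = 0, where `Ψ` vanishes because
    -- g_k = 0. Elsewhere the claim is `rest`, the induction hypothesis of the caller.
    W-NE≈Ψ : ∀ L y i x → y ℕ.+ i ≡ h →
             (∀ i → suc y ℕ.+ i ≡ h → W L (suc y) true (suc x) ≈ Ψ (suc y) (suc i) (suc x)) →
             W-NE L y x ≈ Ψ (suc y) i (suc x)
    W-NE≈Ψ L y i x y+i≡h rest with suc y <ᵇ suc h in eq
    W-NE≈Ψ L y zero    x y+i≡h rest | true  =
      contradiction (ℕₚ.<ᵇ⇒< y h (≡.subst T (≡.sym eq) tt))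
                    (ℕₚ.≤⇒≯ (ℕₚ.≤-reflexive (≡.trans (≡.sym y+i≡h) (ℕₚ.+-identityʳ y))))
    W-NE≈Ψ L y (suc i) x y+i≡h rest | true  = rest i (≡.trans (≡.sym (ℕₚ.+-suc y i)) y+i≡h)
    W-NE≈Ψ L y zero    x y+i≡h rest | false =
      sym (trans (reflexive (≡.cong (λ y → Ψ (suc y) 0 (suc x)) (≡.trans (≡.sym (ℕₚ.+-identityʳ y)) y+i≡h)))
                 (Ψ-top (suc x)))
    W-NE≈Ψ L y (suc i) x y+i≡h rest | false =
      contradiction (ℕₚ.<⇒<ᵇ (ℕₚ.≤-trans (ℕₚ.m≤m+n (suc y) i)
                       (ℕₚ.≤-reflexive (≡.trans (≡.sym (ℕₚ.+-suc y i)) y+i≡h))))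
                    (≡.subst T eq)

    -- A South step leaves x unchanged, but the step after it does not; so the abscissa reaches
    -- x + e ≥ M, where only peakless paths count, within 2e + 1 steps.  The h further steps let
    -- such a path come down to height 0.
    W≈Φ : ∀ L e x y i → M ≤ e ℕ.+ x → y ℕ.+ i ≡ h → e ℕ.+ e ℕ.+ h ≤ L →
          W L y false x ≈ Φ (suc y) i x
    W≈Ψ : ∀ L e x y i → M ≤ e ℕ.+ x → suc y ℕ.+ i ≡ h → e ℕ.+ e ℕ.+ h < L →
          W L (suc y) true x ≈ Ψ (suc y) (suc i) x
    W≈Φ L zero x y i M≤x y+i≡h h≤L = trans
      (W-large-false L y M≤x (ℕₚ.≤-trans (ℕₚ.m+n≤o⇒m≤o y (ℕₚ.≤-reflexive y+i≡h)) h≤L))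
      (sym (Φ-large (suc y) i M≤x))
    W≈Φ (suc L) (suc e) x zero i M≤x ≡.refl (s≤s b) = begin
      W (suc L) 0 false x                   ≈⟨ W-zero L x ⟩
      W-NE L 0 x + W L 0 false (suc x)
        ≈⟨ +-cong (W-NE≈Ψ L 0 i x ≡.refl (λ i p → W≈Ψ L e (suc x) 0 i M≤ p b′))
                  (W≈Φ L e (suc x) 0 i M≤ ≡.refl (ℕₚ.<⇒≤ b′)) ⟩
      Ψ 1 i (suc x) + Φ 1 i (suc x)         ≈⟨ +-congˡ (Φ-reflect (suc x)) ⟨
      Ψ 1 i (suc x) + Φ 0 (suc i) (suc x)   ≈⟨ Φ-rec 0 i x ⟨
      Φ 1 i x                               ∎
      where
      M≤ = ≡.subst (M ≤_) (≡.sym (ℕₚ.+-suc e x)) M≤x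
      b′ = ≡.subst (λ l → l ℕ.+ h ≤ L) (ℕₚ.+-suc e e) b
    W≈Φ (suc L) (suc e) x (suc y) i M≤x p (s≤s b) = begin
      W (suc L) (suc y) false x             ≈⟨ W-suc-false L y x ⟩
      W-NE L (suc y) x + W L y false (suc x)
        ≈⟨ +-cong (W-NE≈Ψ L (suc y) i x p (λ i p → W≈Ψ L e (suc x) (suc y) i M≤ p b′))
                  (W≈Φ L e (suc x) y (suc i) M≤ (≡.trans (ℕₚ.+-suc y i) p) (ℕₚ.<⇒≤ b′)) ⟩
      Ψ (2 ℕ.+ y) i (suc x) + Φ (suc y) (suc i) (suc x)   ≈⟨ Φ-rec (suc y) i x ⟨
      Φ (2 ℕ.+ y) i x                       ∎
      where
      M≤ = ≡.subst (M ≤_) (≡.sym (ℕₚ.+-suc e x)) M≤x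
      b′ = ≡.subst (λ l → l ℕ.+ h ≤ L) (ℕₚ.+-suc e e) b
    W≈Ψ L zero x y i M≤x p b =
      trans (W-large-true L y M≤x) (sym (Ψ-large (suc y) (suc i) M≤x))
    W≈Ψ (suc L) (suc e) x y i M≤x p (s≤s b) = begin
      W (suc L) (suc y) true x              ≈⟨ W-suc-true L y x ⟩
      W-NE L (suc y) x + q ^ x * (W L y false (suc x) + a * W L y false x)
        ≈⟨ +-cong (W-NE≈Ψ L (suc y) i x p (λ i p → W≈Ψ L e (suc x) (suc y) i M≤ p b′))
             (*-congˡ (+-cong
               (W≈Φ L e (suc x) y (suc i) M≤ p′ (ℕₚ.<⇒≤ b′))
               (*-congˡ (W≈Φ L (suc e) x y (suc i) M≤x p′ b)))) ⟩
      Ψ (2 ℕ.+ y) i (suc x) + q ^ x * (Φ (suc y) (suc i) (suc x) + a * Φ (suc y) (suc i) x)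
        ≈⟨ Ψ-rec (suc y) i x ⟨
      Ψ (suc y) (suc i) x                   ∎
      where
      M≤ = ≡.subst (M ≤_) (≡.sym (ℕₚ.+-suc e x)) M≤x
      b′ = ℕₚ.<⇒≤ (≡.subst (λ l → suc l ℕ.+ h ≤ L) (ℕₚ.+-suc e e) b)
      p′ = ≡.trans (ℕₚ.+-suc y i) p

-- Coefficients of the concrete series

≤ᵇ-suc : ∀ m n → (suc m ≤ᵇ suc n) ≡ (m ≤ᵇ n)
≤ᵇ-suc zero    n = ≡.refl
≤ᵇ-suc (suc m) n = ≡.refl

≡ᵇ-+ : ∀ r s N → (N ≡ᵇ r ℕ.+ s) ≡ (if r ≤ᵇ N then N ∸ r ≡ᵇ s else false)
≡ᵇ-+ zero    s N       = ≡.refl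
≡ᵇ-+ (suc r) s zero    = ≡.refl
≡ᵇ-+ (suc r) s (suc N) rewrite ≤ᵇ-suc r N = ≡ᵇ-+ r s N

≡ᵇ-comm : ∀ m n → (m ≡ᵇ n) ≡ (n ≡ᵇ m)
≡ᵇ-comm zero    zero    = ≡.refl
≡ᵇ-comm zero    (suc n) = ≡.refl
≡ᵇ-comm (suc m) zero    = ≡.refl
≡ᵇ-comm (suc m) (suc n) = ≡ᵇ-comm m n

qShift-≤ : ∀ {e N} f J → e ≤ N → qShift e f N J ≡ f (N ∸ e) J
qShift-≤ {e} {N} f J e≤N with e ≤ᵇ N | ℕₚ.≤⇒≤ᵇ e≤N
... | true | _ = ≡.refl

qShift-> : ∀ {e N} f J → N < e → qShift e f N J ≡ + 0
qShift-> {e} {N} f J N<e with e ≤ᵇ N in eq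
... | true  = contradiction (ℕₚ.≤ᵇ⇒≤ e N (≡.subst T (≡.sym eq) tt)) (ℕₚ.<⇒≱ N<e)
... | false = ≡.refl

qShift-suc : ∀ e f N J → qShift (suc e) f (suc N) J ≡ qShift e f N J
qShift-suc e f N J rewrite ≤ᵇ-suc e N = ≡.refl

sumTo-head : ∀ N f → sumTo (suc N) f ≡ f 0 ℤ.+ sumTo N (f ∘ suc)
sumTo-head zero    f = ≡.refl
sumTo-head (suc N) f = ≡.trans (≡.cong (ℤ._+ f (2 ℕ.+ N)) (sumTo-head N f)) (ℤₚ.+-assoc (f 0) _ _)

monomial : ℕ → ℕ → PS
monomial m s N J = bool→ℤ ((N ≡ᵇ m) ∧ (J ≡ᵇ s))

qShift-monomial : ∀ e s N J → qShift e (monomial 0 s) N J ≡ monomial e s N J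
qShift-monomial e s N J rewrite ≡.cong (N ≡ᵇ_) (≡.sym (ℕₚ.+-identityʳ e)) | ≡ᵇ-+ e 0 N with e ≤ᵇ N
... | true  = ≡.refl
... | false = ≡.refl

aShift : PS → PS
aShift f N zero    = + 0
aShift f N (suc J) = f N J

-- Below m + 1 a number is its own remainder, so only N = 0 counts; from there on, N and N - (m + 1)
-- have the same remainder.
invOneMinusQ-rec : ∀ m N J → let f = invOneMinusQ (suc m) in
                   f N J ≡ oneS N J ℤ.+ qShift (suc m) f N J
invOneMinusQ-rec m N J with suc m ℕ.≤? N
... | no m≰N rewrite qShift-> (invOneMinusQ (suc m)) J (ℕₚ.≰⇒> m≰N)
                   | m<n⇒m%n≡m (ℕₚ.≰⇒> m≰N) = bools (J ≡ᵇ 0) (N ≡ᵇ 0)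
  where
  bools : ∀ b c → (if b ∧ c then + 1 else + 0) ≡ bool→ℤ (c ∧ b) ℤ.+ + 0
  bools true  true  = ≡.refl
  bools true  false = ≡.refl
  bools false true  = ≡.refl
  bools false false = ≡.refl
invOneMinusQ-rec m zero    J | yes ()
invOneMinusQ-rec m (suc N) J | yes m≤N rewrite qShift-≤ (invOneMinusQ (suc m)) J m≤N =
  ≡.trans (≡.cong (λ r → if (J ≡ᵇ 0) ∧ (r ≡ᵇ 0) then + 1 else + 0) remainder) (≡.sym (ℤₚ.+-identityˡ _))
  where
  remainder : suc N % suc m ≡ (N ∸ m) % suc m
  remainder = ≡.trans (≡.cong (_% suc m) (≡.sym (ℕₚ.m∸n+n≡m m≤N))) ([m+n]%n≡m%n (N ∸ m) (suc m))

invOnePlusAQ-rec : ∀ r N J → let f = invOnePlusAQ r in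
                   f N J ℤ.+ aShift (qShift r f) N J ≡ oneS N J
invOnePlusAQ-rec r N zero rewrite ℕₚ.*-zeroʳ r with N ≡ᵇ 0
... | true  = ≡.refl
... | false = ≡.refl
invOnePlusAQ-rec r N (suc J) rewrite ℕₚ.*-suc r J | ≡ᵇ-+ r (r ℕ.* J) N | Boolₚ.∧-zeroʳ (N ≡ᵇ 0)
  with r ≤ᵇ N
... | false = ≡.refl
... | true with N ∸ r ≡ᵇ r ℕ.* J
...   | true  = ℤₚ.+-inverseˡ (sgn J)
...   | false = ≡.refl

length-filterᵇ-∷ : ∀ (p : List Step → Bool) w ws →
  bool→ℤ (p w) ℤ.+ (+ length (filterᵇ p ws)) ≡ + length (filterᵇ p (w ∷ ws))
length-filterᵇ-∷ p w ws with p w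
... | true  = ≡.refl
... | false = ≡.refl

-- The truncated ring of power series in a and q

module ℤ[[a]] = PowerSeries ℤₚ.+-*-commutativeRing

module Truncated (n j : ℕ) where

  module ℤ[[a,q]] = PowerSeries (ℤ[[a]].truncated j)

  ℛ : CommutativeRing _ _
  ℛ = ℤ[[a,q]].truncated n

  open CommutativeRing ℛ
  open Exp semiring using (_^_; ^-homo-*)
  open import Relation.Binary.Reasoning.Setoid setoid
  open import Algebra.Properties.Ring ring using (-‿distribˡ-*)
  open import Algebra.Solver.Ring.NaturalCoefficients.Default commutativeSemiring
    using (solve; _:+_; _:*_; _:=_; con)

  pointwise : ∀ {f g : PS} → (∀ N J → f N J ≡ g N J) → f ≈ g
  pointwise p N _ J _ = p N J

  -- Both are Cauchy products, but `sumTo` adds its terms at the end and `_⋆_` at the front.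
  ⊛≈* : ∀ f g → f ⊛ g ≈ f * g
  ⊛≈* f g = pointwise (λ N J → outer N J f)
    where
    inner : ∀ J (φ γ : ℕ → ℤ) → sumTo J (λ l → φ l ℤ.* γ (J ∸ l)) ≡ (φ ℤ[[a]].⋆ γ) J
    inner zero    φ γ = ≡.refl
    inner (suc J) φ γ = ≡.trans (sumTo-head J _) (≡.cong (λ x → φ 0 ℤ.* γ (suc J) ℤ.+ x) (inner J (φ ∘ suc) γ))
    outer : ∀ N J f → (f ⊛ g) N J ≡ (f * g) N J
    outer zero    J f = inner J (f 0) (g 0)
    outer (suc N) J f = ≡.trans (sumTo-head N _) (≡.cong₂ ℤ._+_ (inner J (f 0) (g (suc N))) (outer N J (f ∘ suc)))

  oneS≈1 : oneS ≈ 1#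
  oneS≈1 zero    _ zero    _ = ≡.refl
  oneS≈1 zero    _ (suc J) _ = ≡.refl
  oneS≈1 (suc N) _ J       _ = ≡.refl

  q a : PS
  q = monomial 1 0
  a = monomial 0 1

  q-* : ∀ f → q * f ≈ qShift 1 f
  q-* f zero    _   J _ = ℤ[[a]].⋆-zeroˡ (f 0) J
  q-* f (suc N) N≤n J J≤j = ≡.trans
    (≡.cong₂ ℤ._+_ (ℤ[[a]].⋆-zeroˡ (f (suc N)) J)
      (trans (*-congʳ oneS≈1) (*-identityˡ f) N (ℕₚ.≤-trans (ℕₚ.n≤1+n N) N≤n) J J≤j))
    (ℤₚ.+-identityˡ _)

  q^-* : ∀ e f → q ^ e * f ≈ qShift e f
  q^-* zero    f = *-identityˡ f
  q^-* (suc e) f = begin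
    q * q ^ e * f         ≈⟨ *-assoc _ _ _ ⟩
    q * (q ^ e * f)       ≈⟨ *-congˡ (q^-* e f) ⟩
    q * qShift e f        ≈⟨ q-* _ ⟩
    qShift 1 (qShift e f) ≈⟨ pointwise shift ⟩
    qShift (suc e) f      ∎
    where
    shift : ∀ N J → qShift 1 (qShift e f) N J ≡ qShift (suc e) f N J
    shift zero    J = ≡.refl
    shift (suc N) J = ≡.sym (qShift-suc e f N J)

  q^≈ : ∀ e → q ^ e ≈ monomial e 0
  q^≈ e = begin
    q ^ e               ≈⟨ *-identityʳ _ ⟨
    q ^ e * 1#          ≈⟨ *-congˡ oneS≈1 ⟨
    q ^ e * oneS        ≈⟨ q^-* e oneS ⟩
    qShift e oneS       ≈⟨ pointwise (qShift-monomial e 0) ⟩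
    monomial e 0        ∎

  a-* : ∀ f → a * f ≈ aShift f
  a-* f N N≤n J J≤j = ≡.trans
    (≡.trans (*-congʳ {f} constant N N≤n J J≤j) (ℤ[[a,q]].const-⋆ (a 0) f N J J≤j))
    (shift J)
    where
    constant : a ≈ ℤ[[a,q]].const (a 0)
    constant zero    _ J _ = ≡.refl
    constant (suc N) _ J _ = ≡.refl
    one : ∀ J → bool→ℤ (J ≡ᵇ 0) ≡ ℤ[[a]].const (+ 1) J
    one zero    = ≡.refl
    one (suc J) = ≡.refl
    shift : ∀ J → (a 0 ℤ[[a]].⋆ f N) J ≡ aShift f N J
    shift zero    = ≡.refl
    shift (suc J) = ≡.trans (≡.cong₂ ℤ._+_ (ℤₚ.*-zeroˡ (f N (suc J)))
      (≡.trans (ℤ[[a]].⋆-cong one (λ _ → ≡.refl) J) (ℤ[[a]].⋆-identityˡ (f N) J))) (ℤₚ.+-identityˡ _)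

  a^≈ : ∀ s → a ^ s ≈ monomial 0 s
  a^≈ zero    = sym oneS≈1
  a^≈ (suc s) = begin
    a * a ^ s              ≈⟨ *-congˡ (a^≈ s) ⟩
    a * monomial 0 s       ≈⟨ a-* _ ⟩
    aShift (monomial 0 s)  ≈⟨ pointwise shift ⟩
    monomial 0 (suc s)     ∎
    where
    shift : ∀ N J → aShift (monomial 0 s) N J ≡ monomial 0 (suc s) N J
    shift N zero    rewrite Boolₚ.∧-zeroʳ (N ≡ᵇ 0) = ≡.refl
    shift N (suc J) = ≡.refl

  q^*a^≈ : ∀ m s → q ^ m * a ^ s ≈ monomial m s
  q^*a^≈ m s = trans (*-congˡ (a^≈ s)) (trans (q^-* m _) (pointwise (qShift-monomial m s)))

  onePlusAQ≈ : ∀ r → onePlusAQ r ≈ 1# + a * q ^ r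
  onePlusAQ≈ r = begin
    onePlusAQ r            ≈⟨ +-cong oneS≈1 (sym (q^*a^≈ r 1)) ⟩
    1# + q ^ r * (a * 1#)  ≈⟨ +-congˡ {1#} (trans (*-congˡ {q ^ r} (*-identityʳ a)) (*-comm (q ^ r) a)) ⟩
    1# + a * q ^ r         ∎

  aPlusQ≈ : ∀ r → aPlusQ r ≈ a + q ^ r
  aPlusQ≈ r = +-congˡ {a} (sym (q^≈ r))

  base : NilpotentBase ℛ
  base = record
    { a = a
    ; q = q
    ; M = suc n
    ; q^M≈0 = trans (q^≈ (suc n)) (λ N N≤n J J≤j → ≡.trans
        (≡.sym (qShift-monomial (suc n) 0 N J)) (qShift-> (monomial 0 0) J (s≤s N≤n)))
    ; iq = λ m → invOneMinusQ (suc m)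
    ; ia = λ m → invOnePlusAQ (suc m)
    ; iq-inverse = λ m → trans (pointwise (invOneMinusQ-rec m)) (+-cong oneS≈1 (sym (q^-* (suc m) _)))
    ; ia-inverse = λ m → begin
        (1# + a * q ^ suc m) * f m             ≈⟨ solve 3 (λ x y z → (con 1 :+ x :* y) :* z := z :+ x :* (y :* z)) refl _ _ _ ⟩
        f m + a * (q ^ suc m * f m)            ≈⟨ +-congˡ {f m} (trans (*-congˡ {a} (q^-* (suc m) (f m))) (a-* _)) ⟩
        f m + aShift (qShift (suc m) (f m))    ≈⟨ pointwise (invOnePlusAQ-rec (suc m)) ⟩
        oneS                                   ≈⟨ oneS≈1 ⟩
        1#                                     ∎
    }
    where
    f : ℕ → PS
    f m = invOnePlusAQ (suc m)

  open FiniteSums ℛ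
  open QSeries ℛ base

  prodFrom-last : ∀ s m F → prodFrom s (suc m) F ≈ prodFrom s m F * F (m ℕ.+ s)
  prodFrom-last s zero    F = trans (⊛≈* (F s) oneS) (*-comm _ _)
  prodFrom-last s (suc m) F = begin
    F s ⊛ prodFrom (suc s) (suc m) F              ≈⟨ ⊛≈* _ _ ⟩
    F s * prodFrom (suc s) (suc m) F              ≈⟨ *-congˡ (prodFrom-last (suc s) m F) ⟩
    F s * (prodFrom (suc s) m F * F (m ℕ.+ suc s)) ≈⟨ *-assoc _ _ _ ⟨
    F s * prodFrom (suc s) m F * F (m ℕ.+ suc s)
      ≈⟨ *-cong (sym (⊛≈* _ _)) (reflexive (≡.cong F (ℕₚ.+-suc m s))) ⟩
    prodFrom s (suc m) F * F (suc m ℕ.+ s)        ∎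

  prodFrom-rec : ∀ s F (X : ℕ → PS) → X 0 ≈ 1# → (∀ m → X (suc m) ≈ X m * F (m ℕ.+ s)) →
                 ∀ m → prodFrom s m F ≈ X m
  prodFrom-rec s F X X₀ Xₛ zero    = trans oneS≈1 (sym X₀)
  prodFrom-rec s F X X₀ Xₛ (suc m) =
    trans (prodFrom-last s m F) (trans (*-congʳ (prodFrom-rec s F X X₀ Xₛ m)) (sym (Xₛ m)))

  aPowNegInvA≈ : ∀ m → aPowNegInvA m ≈ P m
  aPowNegInvA≈ = prodFrom-rec 0 aPlusQ P refl
    (λ m → *-congˡ (sym (trans (reflexive (≡.cong aPlusQ (ℕₚ.+-identityʳ m))) (aPlusQ≈ m))))

  from1 : ∀ (F : ℕ → PS) m → F (suc m) ≈ F (m ℕ.+ 1)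
  from1 F m = reflexive (≡.cong F (≡.sym (ℕₚ.+-comm m 1)))

  invNegAQ≈ : ∀ m → invNegAQ m ≈ invAQPoch m
  invNegAQ≈ = prodFrom-rec 1 invOnePlusAQ invAQPoch refl
    (λ m → trans (*-comm _ _) (*-congˡ (from1 invOnePlusAQ m)))

  negAQ≈ : ∀ m → prodFrom 1 m onePlusAQ ≈ aqPoch m
  negAQ≈ = prodFrom-rec 1 onePlusAQ aqPoch refl
    (λ m → trans (*-comm _ _) (*-congˡ (trans (sym (onePlusAQ≈ (suc m))) (from1 onePlusAQ m))))

  invQ≈ : ∀ m → prodFrom 1 m invOneMinusQ ≈ invQPoch m
  invQ≈ = prodFrom-rec 1 invOneMinusQ invQPoch refl
    (λ m → trans (*-comm _ _) (*-congˡ (from1 invOneMinusQ m)))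

  negAQ-stable : ∀ {m} → n ≤ m → prodFrom 1 n onePlusAQ n j ≡ prodFrom 1 m onePlusAQ n j
  negAQ-stable {m} n≤m = ≡.sym ((begin
    prodFrom 1 m onePlusAQ   ≈⟨ negAQ≈ m ⟩
    aqPoch m                 ≡⟨ ≡.cong aqPoch (ℕₚ.m∸n+n≡m n≤m) ⟨
    aqPoch (m ∸ n ℕ.+ n)     ≈⟨ aqPoch-stable (m ∸ n) ℕₚ.≤-refl ⟩
    aqPoch n                 ≈⟨ negAQ≈ n ⟨
    prodFrom 1 n onePlusAQ   ∎) n ℕₚ.≤-refl j ℕₚ.≤-refl)

  invQ-stable : ∀ {m} → n ≤ m → prodFrom 1 n invOneMinusQ n j ≡ prodFrom 1 m invOneMinusQ n j
  invQ-stable {m} n≤m = ≡.sym ((begin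
    prodFrom 1 m invOneMinusQ   ≈⟨ invQ≈ m ⟩
    invQPoch m                    ≡⟨ ≡.cong invQPoch (ℕₚ.m∸n+n≡m n≤m) ⟨
    invQPoch (m ∸ n ℕ.+ n)        ≈⟨ invQPoch-stable (m ∸ n) ℕₚ.≤-refl ⟩
    invQPoch n                    ≈⟨ invQ≈ n ⟨
    prodFrom 1 n invOneMinusQ   ∎) n ℕₚ.≤-refl j ℕₚ.≤-refl)

  sign-* : ∀ m f → sign m * f ≈ scale (sgn m) f
  sign-* zero    f = trans (*-identityˡ f) (pointwise (λ N J → ≡.sym (ℤₚ.*-identityˡ (f N J))))
  sign-* (suc m) f = begin
    - sign m * f           ≈⟨ -‿distribˡ-* (sign m) f ⟨
    - (sign m * f)         ≈⟨ -‿cong (sign-* m f) ⟩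
    - scale (sgn m) f      ≈⟨ pointwise (λ N J → ℤₚ.neg-distribˡ-* (sgn m) (f N J)) ⟩
    scale (sgn (suc m)) f  ∎

  -- The power q^{m(m+1)/2} inside `τ m` completes e to the exponent of the summand. One statement
  -- serves n = m and n = -m, since the remaining factor depends on |n| alone.
  summand-form : ∀ m e e′ → e ℕ.+ triangle (suc m) ≡ e′ →
    sign m * q ^ e * (τ m * invAQPoch m) ≈ scale (sgn m) (qShift e′ (aPowNegInvA m ⊛ invNegAQ m))
  summand-form m e e′ p = begin
    sign m * q ^ e * (q ^ triangle (suc m) * P m * invAQPoch m)
      ≈⟨ solve 5 (λ s x y P I → s :* x :* (y :* P :* I) := s :* ((x :* y) :* (P :* I))) refl _ _ _ _ _ ⟩
    sign m * (q ^ e * q ^ triangle (suc m) * (P m * invAQPoch m))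
      ≈⟨ *-congˡ (*-cong (trans (sym (^-homo-* q e _)) (reflexive (≡.cong (q ^_) p)))
           (sym (trans (⊛≈* _ _) (*-cong (aPowNegInvA≈ m) (invNegAQ≈ m))))) ⟩
    sign m * (q ^ e′ * (aPowNegInvA m ⊛ invNegAQ m))   ≈⟨ *-congˡ (q^-* e′ _) ⟩
    sign m * qShift e′ (aPowNegInvA m ⊛ invNegAQ m)    ≈⟨ sign-* m _ ⟩
    scale (sgn m) (qShift e′ (aPowNegInvA m ⊛ invNegAQ m)) ∎

  symSum≈∑ : ∀ B (t : ℤ → PS) → (λ N J → symSum B (λ z → t z N J)) ≈
             t (+ 0) + ∑ B (λ m → t (+ suc m) + t -[1+ m ])
  symSum≈∑ zero    t = sym (+-identityʳ _)
  symSum≈∑ (suc B) t = trans (+-congʳ {t (+ suc B) + t -[1+ B ]} (symSum≈∑ B t))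
    (+-assoc (t (+ 0)) (∑ B (λ m → t (+ suc m) + t -[1+ m ])) (t (+ suc B) + t -[1+ B ]))

  module Count (h : ℕ) where
    open Paths h

    counted : ℕ → List Step → Bool
    counted y w = (walk (suc h) y false w ∧ endsDown w)
                  ∧ ((majorIndex w ≡ᵇ n) ∧ (southSteps w ≡ᵇ j))

    listSum-coefficient : ∀ y ws → listSum (weight y false 0) ws n j ≡ + length (filterᵇ (counted y) ws)
    listSum-coefficient y []       = ≡.refl
    listSum-coefficient y (w ∷ ws) = ≡.trans
      (≡.cong₂ ℤ._+_ (coefficient (walk (suc h) y false w ∧ endsDown w) (majorIndex w) (southSteps w))
                     (listSum-coefficient y ws))
      (length-filterᵇ-∷ (counted y) w ws)
      where
      coefficient : ∀ p m s → (if p then q ^ m * a ^ s else 0#) n j ≡ bool→ℤ (p ∧ ((m ≡ᵇ n) ∧ (s ≡ᵇ j)))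
      coefficient true  m s = ≡.trans (q^*a^≈ m s n ℕₚ.≤-refl j ℕₚ.≤-refl)
        (≡.cong₂ (λ b c → bool→ℤ (b ∧ c)) (≡ᵇ-comm n m) (≡ᵇ-comm j s))
      coefficient false m s = ≡.refl

-- Identities between exponents

2*triangle : ∀ m → triangle m ℕ.+ triangle m ℕ.+ m ≡ m ℕ.* m
2*triangle zero    = ≡.refl
2*triangle (suc m) = ≡.trans
  (NS.solve 2 (λ t m → t NS.:+ m NS.:+ (t NS.:+ m) NS.:+ (NS.con 1 NS.:+ m)
                NS.:= t NS.:+ t NS.:+ m NS.:+ m NS.:+ m NS.:+ NS.con 1) ≡.refl (triangle m) m)
  (≡.trans (≡.cong (λ s → s ℕ.+ m ℕ.+ m ℕ.+ 1) (2*triangle m))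
    (NS.solve 1 (λ m → m NS.:* m NS.:+ m NS.:+ m NS.:+ NS.con 1
                NS.:= (NS.con 1 NS.:+ m) NS.:* (NS.con 1 NS.:+ m)) ≡.refl m))

exponent⁺ : ∀ h w m → suc (h ℕ.+ h) ℕ.* triangle m ℕ.+ (h ℕ.+ suc w) ℕ.* m ℕ.+ triangle (suc m) ≡
            suc h ℕ.* m ℕ.* m ℕ.+ suc w ℕ.* m
exponent⁺ h w m = ≡.trans
  (NS.solve 4 (λ h w m t →
    (NS.con 1 NS.:+ (h NS.:+ h)) NS.:* t NS.:+ (h NS.:+ (NS.con 1 NS.:+ w)) NS.:* m NS.:+ (t NS.:+ m)
    NS.:= (NS.con 1 NS.:+ h) NS.:* (t NS.:+ t NS.:+ m) NS.:+ (NS.con 1 NS.:+ w) NS.:* m)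
    ≡.refl h w m (triangle m))
  (≡.cong (ℕ._+ suc w ℕ.* m) (≡.trans (≡.cong (suc h ℕ.*_) (2*triangle m)) (≡.sym (ℕₚ.*-assoc (suc h) m m))))

-- Adding w m to the left side and subtracting it again shows that the truncated subtraction is
-- exact and leaves a polynomial identity.
exponent⁻ : ∀ h i w m → w ℕ.+ i ≡ h →
            suc (h ℕ.+ h) ℕ.* triangle m ℕ.+ i ℕ.* m ℕ.+ triangle (suc m) ≡
            suc h ℕ.* m ℕ.* m ∸ w ℕ.* m
exponent⁻ h i w m ≡.refl = ≡.trans (≡.sym (ℕₚ.m+n∸n≡m _ (w ℕ.* m))) (≡.cong (_∸ w ℕ.* m) (≡.trans
  (NS.solve 4 (λ w i m t →
    (NS.con 1 NS.:+ (w NS.:+ i NS.:+ (w NS.:+ i))) NS.:* t NS.:+ i NS.:* m NS.:+ (t NS.:+ m) NS.:+ w NS.:* m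
    NS.:= (NS.con 1 NS.:+ (w NS.:+ i)) NS.:* (t NS.:+ t NS.:+ m))
    ≡.refl w i m (triangle m))
  (≡.trans (≡.cong (suc h ℕ.*_) (2*triangle m)) (≡.sym (ℕₚ.*-assoc (suc h) m m)))))

-- The bilateral series and the comparison of coefficients

module Summation (h i : ℕ) (i≤h : i ≤ h) where

  -- Here k = h + 1, and `suc i` is the i of the theorem, so this is k - i. The shifted `i` is the
  -- distance up to the highest admissible vertex, as required by `W≈Φ`.
  height : ℕ
  height = h ∸ i

  height+i≡h : height ℕ.+ i ≡ h
  height+i≡h = ℕₚ.m∸n+n≡m i≤h

  term : ℤ → PS
  term = summand (suc h) (suc i)

  -- The n-th summand is divisible by q^|n|, so the coefficient of q^N needs only |n| ≤ N.
  seriesSum : PS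
  seriesSum N J = symSum N (λ z → term z N J)

  term⁺-vanish : ∀ m {N} J → N < m → term (+ m) N J ≡ + 0
  term⁺-vanish m J N<m = ≡.trans (≡.cong (sgn m ℤ.*_)
    (qShift-> (aPowNegInvA m ⊛ invNegAQ m) J (ℕₚ.≤-trans N<m
      (ℕₚ.≤-trans (ℕₚ.m≤m+n m (height ℕ.* m)) (ℕₚ.m≤n+m _ (suc h ℕ.* m ℕ.* m))))))
    (ℤₚ.*-zeroʳ (sgn m))

  -- The exponent is bounded below through `exponent⁻`, whose subtraction-free side contains m + 1
  -- as a summand.
  term⁻-vanish : ∀ m {N} J → N < suc m → term -[1+ m ] N J ≡ + 0
  term⁻-vanish m J N<m = ≡.trans (≡.cong (sgn (suc m) ℤ.*_)
    (qShift-> (aPowNegInvA (suc m) ⊛ invNegAQ (suc m)) J (ℕₚ.≤-trans N<m (ℕₚ.≤-trans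
      (ℕₚ.≤-trans (ℕₚ.m≤n+m (suc m) (triangle (suc m)))
        (ℕₚ.m≤n+m _ (suc (h ℕ.+ h) ℕ.* triangle (suc m) ℕ.+ i ℕ.* suc m)))
      (ℕₚ.≤-reflexive (exponent⁻ h i height (suc m) height+i≡h))))))
    (ℤₚ.*-zeroʳ (sgn (suc m)))

  seriesSum-stable : ∀ N J d → seriesSum N J ≡ symSum (d ℕ.+ N) (λ z → term z N J)
  seriesSum-stable N J zero    = ≡.refl
  seriesSum-stable N J (suc d) = ≡.trans (seriesSum-stable N J d) (≡.sym (≡.trans
    (≡.cong₂ (λ x y → symSum (d ℕ.+ N) (λ z → term z N J) ℤ.+ (x ℤ.+ y))
      (term⁺-vanish _ J (s≤s (ℕₚ.m≤n+m N d))) (term⁻-vanish _ J (s≤s (ℕₚ.m≤n+m N d))))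
    (ℤₚ.+-identityʳ _)))

  seriesSum-isSum : IsSumℤ term seriesSum
  seriesSum-isSum N J = N , λ B N≤B → ≡.trans (seriesSum-stable N J (B ∸ N))
    (≡.cong (λ B → symSum B (λ z → term z N J)) (ℕₚ.m∸n+n≡m N≤B))

  module _ (n j : ℕ) where
    open Truncated n j
    open CommutativeRing ℛ
    open FiniteSums ℛ
    open QSeries ℛ base
    open Paths h
    open Count h
    open import Relation.Binary.Reasoning.Setoid setoid

    -- The number of factors in `infProd` varies with the coefficient, so each coefficient (N, J) is
    -- compared in its own truncation before passing to n + 1 factors.
    negAQ∞≈ : negAQ∞ ≈ aqPoch (suc n)
    negAQ∞≈ = trans (λ N N≤n J _ → Truncated.negAQ-stable N J (ℕₚ.m≤n⇒m≤1+n N≤n)) (negAQ≈ (suc n))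

    invQ∞≈ : invQ∞ ≈ invQPoch (suc n)
    invQ∞≈ = trans (λ N N≤n J _ → Truncated.invQ-stable N J (ℕₚ.m≤n⇒m≤1+n N≤n)) (invQ≈ (suc n))

    X Y : ℕ → PS
    X m = A⁺ m (suc height) * (τ m * invAQPoch m)
    Y m = A⁻ m i * (τ (suc m) * invAQPoch (suc m))

    X≈term : ∀ m → X m ≈ term (+ m)
    X≈term m = summand-form m (κ ℕ.* triangle m ℕ.+ (h ℕ.+ suc height) ℕ.* m) _ (exponent⁺ h height m)

    Y≈term : ∀ m → Y m ≈ term -[1+ m ]
    Y≈term m = summand-form (suc m) (κ ℕ.* triangle (suc m) ℕ.+ i ℕ.* suc m) _
      (exponent⁻ h i height (suc m) height+i≡h)

    seriesSum≈ : seriesSum ≈ ∑ (suc (suc n)) (λ m → X m + Y m)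
    seriesSum≈ = sym (begin
      ∑ (suc (suc n)) (λ m → X m + Y m)                ≈⟨ ∑-+ (suc (suc n)) X Y ⟩
      ∑ (suc (suc n)) X + (∑ (suc n) Y + Y (suc n))
        ≈⟨ +-cong (∑-head (suc n) X) (trans (+-congˡ {∑ (suc n) Y} Y-last) (+-identityʳ (∑ (suc n) Y))) ⟩
      X 0 + ∑ (suc n) (X ∘ suc) + ∑ (suc n) Y
        ≈⟨ +-assoc (X 0) (∑ (suc n) (X ∘ suc)) (∑ (suc n) Y) ⟩
      X 0 + (∑ (suc n) (X ∘ suc) + ∑ (suc n) Y)
        ≈⟨ +-congˡ {X 0} (∑-+ (suc n) (X ∘ suc) Y) ⟨
      X 0 + ∑ (suc n) (λ m → X (suc m) + Y m)
        ≈⟨ +-cong (X≈term 0) (∑-cong (suc n) (λ m → +-cong (X≈term (suc m)) (Y≈term m))) ⟩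
      term (+ 0) + ∑ (suc n) (λ m → term (+ suc m) + term -[1+ m ])
        ≈⟨ symSum≈∑ (suc n) term ⟨
      (λ N J → symSum (suc n) (λ z → term z N J))
        ≈⟨ (λ N N≤n J _ → ≡.sym (≡.trans (seriesSum-stable N J (suc n ∸ N))
             (≡.cong (λ B → symSum B (λ z → term z N J)) (ℕₚ.m∸n+n≡m (ℕₚ.m≤n⇒m≤1+n N≤n))))) ⟩
      seriesSum ∎)
      where
      Y-last : Y (suc n) ≈ 0#
      Y-last = trans (*-congʳ (A⁻-M i)) (zeroˡ _)

    Φ≈product : Φ (suc height) i 0 ≈ negAQ∞ ⊛ invQ∞ ⊛ seriesSum
    Φ≈product = begin
      Φ (suc height) i 0         ≈⟨ Φ-closed (suc height) i ⟩
      aqPoch (suc n) * invQPoch (suc n) * ∑ (suc (suc n)) (λ m → X m + Y m)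
        ≈⟨ *-cong (*-cong negAQ∞≈ invQ∞≈) seriesSum≈ ⟨
      negAQ∞ * invQ∞ * seriesSum ≈⟨ *-congʳ {seriesSum} (⊛≈* negAQ∞ invQ∞) ⟨
      (negAQ∞ ⊛ invQ∞) * seriesSum ≈⟨ ⊛≈* (negAQ∞ ⊛ invQ∞) seriesSum ⟨
      negAQ∞ ⊛ invQ∞ ⊛ seriesSum ∎

    countPaths≡W : ∀ L → + countPathsUpTo (suc h) (suc i) L n j ≡ W L height false 0 n j
    countPaths≡W L = ≡.trans
      (≡.cong (λ b → + length (filterᵇ (λ w → (b ∧ (walk (suc h) height false w ∧ endsDown w))
                                 ∧ ((majorIndex w ≡ᵇ n) ∧ (southSteps w ≡ᵇ j))) (wordsUpTo L)))
        (Equivalence.to Boolₚ.T-≡ (ℕₚ.<⇒<ᵇ (s≤s (ℕₚ.m∸n≤m h i)))))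
      (≡.sym (listSum-coefficient height (wordsUpTo L)))

    -- The induction starts at abscissa 0, at distance e = n + 1 from where q vanishes; hence the
    -- threshold 2e + h.
    countPaths-stable : ∀ L → suc n ℕ.+ suc n ℕ.+ h ≤ L →
                        + countPathsUpTo (suc h) (suc i) L n j ≡ (negAQ∞ ⊛ invQ∞ ⊛ seriesSum) n j
    countPaths-stable L L≥ = ≡.trans (countPaths≡W L)
      (trans (W≈Φ L (suc n) 0 height i (ℕₚ.≤-reflexive (≡.sym (ℕₚ.+-identityʳ (suc n)))) height+i≡h L≥)
             Φ≈product n ℕₚ.≤-refl j ℕₚ.≤-refl)

theorem1p5 : (k i : ℕ) → 1 ≤ k → 1 ≤ i → i ≤ k →
    ∃ λ (Ssum : PS) → IsSumℤ (summand k i) Ssum ×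
    (∀ n j → ∃ λ L₀ → ∀ L → L₀ ≤ L →
    + countPathsUpTo k i L n j ≡ (negAQ∞ ⊛ invQ∞ ⊛ Ssum) n j)
theorem1p5 (suc h) (suc i) _ _ (s≤s i≤h) =
  seriesSum , seriesSum-isSum , λ n j → suc n ℕ.+ suc n ℕ.+ h , countPaths-stable n j
  where open Summation h i i≤h
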